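{- Let $n\ge3$ be odd, $d,R\in\mathbb{Q}$, $d\ne0$, $R$ not a square, $D=d^2-R$, fix a square root $\sqrt R$, let $u$ be a zero of $f_n=f_n(Z,d,R)$ and $\zeta$ a primitive $n$th root of unity. For $k=0,\dots,n-1$ put $$u_k=\frac u2(\zeta^k+\zeta^{ -k})+DA(u)\sqrt R(\zeta^k-\zeta^{ -k})$$ (these are zeros of $f_n$; moreover $u\neq0$ and $A(u)\ne0$). Then for every odd $k\in\{1,\dots,n-1\}$, $$u_k=\frac u2F_k\Big(\frac{u_1+u_{n-1}}{u}\Big)+DA(u)P_k\Big(\frac{u_1-u_{n-1}}{2DA(u)}\Big),$$ and $u_{n-k}$ is obtained by the same expression with the plus sign between the two summands replaced by a minus sign.
   Context: For $k\ge1$, $F_k=\sum_{j=0}^{\lfloor k/2\rfloor}c_{k,j}Z^{k-2j}$ with $c_{k,j}=(-1)^j\frac{k}{k-j}\binom{k-j}{j}$ (so $2\cos(kx)=F_k(2\cos x)$). $f_n(Z,d,R)=\sqrt D^{\,n}F_n(Z/\sqrt D)-2dD^{(n-1)/2}=\sum_{j=0}^{(n-1)/2}c_{n,j}D^jZ^{n-2j}-2dD^{(n-1)/2}$. $A=\frac{1}{2R}\big(F_{n-1}(Z/\sqrt D)-\frac{dZ}{D}\big)\in\mathbb{Q}[Z]$, where $F_{n-1}(Z/\sqrt D)=\sum_{j=0}^{(n-1)/2}c_{n-1,j}D^{\,j-(n-1)/2}Z^{n-1-2j}$. For odd $k$, $P_k=i\sqrt R\,(-1)^{(k-1)/2}F_k\big(Z/(i\sqrt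 R)\big)=(-1)^{(k-1)/2}\sum_{j=0}^{(k-1)/2}c_{k,j}(-R)^{\,j-(k-1)/2}Z^{k-2j}\in\mathbb{Q}[Z]$. -}

module Defs where

open import Algebra.Apartness.Bundles using (HeytingField; HeytingCommutativeRing)
open import Algebra.Bundles using (CommutativeRing)
open import Algebra.Morphism.Structures using (module RingMorphisms)
open import Data.Integer.Base as ℤ using (ℤ; +_; -[1+_])
open import Data.List.Base using (List; []; _∷_; _++_; map; upTo)
open import Data.Nat.Base as ℕ using (ℕ; zero; suc; parity)
open import Data.Nat.Combinatorics using (_C_)
open import Data.Nat.DivMod using () renaming (_/_ to _div_)
open import Data.Parity.Base using (1ℙ)
open import Data.Product.Base using (_×_; _,_; proj₁; proj₂; ∃-syntax; map₁)
open import Data.Rational.Base as ℚ using (ℚ; 0ℚ; 1ℚ)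
import Data.Rational.Properties as ℚₚ
open import Level using (_⊔_) renaming (suc to lsuc)
open import Relation.Binary.PropositionalEquality as ≡ using (_≡_; _≢_)
open import Relation.Nullary.Negation using (¬_)
import Algebra.Apartness.Properties.HeytingCommutativeRing
import Algebra.Properties.Group
import Algebra.Properties.Semiring.Exp

------------------------------------------------------------------------
-- Division and integer powers in a field

module FieldOps {a ℓ₁ ℓ₂} (K : HeytingField a ℓ₁ ℓ₂) where

  open HeytingField K
  open CommutativeRing (HeytingCommutativeRing.commutativeRing heytingCommutativeRing) public
    using (rawRing; semiring)
  open Algebra.Apartness.Properties.HeytingCommutativeRing heytingCommutativeRing public
    using (invertibleˡ⇒#; x-0≈x; x#0y#0→xy#0)
  open Algebra.Properties.Semiring.Exp semiring public using (_^_)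

  inv : (x : Carrier) → x # 0# → Carrier
  inv x x#0 = proj₁ (#⇒invertible x#0)

  inv-inverseˡ : (x : Carrier) (x#0 : x # 0#) → inv x x#0 * x ≈ 1#
  inv-inverseˡ x x#0 =
    trans (*-congˡ (sym (x-0≈x x))) (proj₁ (proj₂ (#⇒invertible x#0)))

  unit⇒#0 : ∀ {x y} → y * x ≈ 1# → x # 0#
  unit⇒#0 {x} {y} yx≈1 = invertibleˡ⇒# (y , trans (*-congˡ (x-0≈x x)) yx≈1)

  infixl 7 _÷_[_]
  _÷_[_] : (x y : Carrier) → y # 0# → Carrier
  x ÷ y [ y#0 ] = x * inv y y#0

  infixr 8 _^[_]_
  _^[_]_ : (x : Carrier) → x # 0# → ℤ → Carrier
  x ^[ x#0 ] (+ m)    = x ^ m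
  x ^[ x#0 ] -[1+ m ] = inv x x#0 ^ suc m

  record IsPrimitiveRoot (n : ℕ) (ζ : Carrier) : Set (ℓ₁ ⊔ ℓ₂) where
    field
      n>0     : 0 ℕ.< n
      ζⁿ≈1    : ζ ^ n ≈ 1#
      minimal : ∀ m → 0 ℕ.< m → m ℕ.< n → ¬ (ζ ^ m ≈ 1#)

  primitive⇒#0 : ∀ {n ζ} → IsPrimitiveRoot n ζ → ζ # 0#
  primitive⇒#0 {suc n} {ζ} p =
    unit⇒#0 (trans (*-comm (ζ ^ n) ζ) (IsPrimitiveRoot.ζⁿ≈1 p))

------------------------------------------------------------------------
-- Rational numbers

open FieldOps ℚₚ.heytingField
  using ()
  renaming ( inv to invℚ; inv-inverseˡ to invℚ-inverseˡ; x#0y#0→xy#0 to p≢0q≢0→pq≢0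
           ; _^_ to _^ℚ_; _^[_]_ to _^ℚ[_]_; _÷_[_] to _÷ℚ_[_])

Odd : ℕ → Set
Odd n = parity n ≡ 1ℙ

IsSquare : ℚ → Set
IsSquare r = ∃[ x ] x ℚ.* x ≡ r

2ℚ : ℚ
2ℚ = + 2 ℚ./ 1

D : (d R : ℚ) → ℚ
D d R = d ℚ.* d ℚ.- R

2≢0 : 2ℚ ≢ 0ℚ
2≢0 ()

nonSquare⇒≢0 : ∀ {R} → ¬ IsSquare R → R ≢ 0ℚ
nonSquare⇒≢0 nsq R≡0 = nsq (0ℚ , ≡.sym R≡0)

nonSquare⇒-≢0 : ∀ {R} → ¬ IsSquare R → ℚ.- R ≢ 0ℚ
nonSquare⇒-≢0 {R} nsq -R≡0 =
  nonSquare⇒≢0 nsq (≡.trans (≡.sym (⁻¹-involutive R)) (≡.cong ℚ.-_ -R≡0))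
  where open Algebra.Properties.Group ℚₚ.+-0-group using (⁻¹-involutive)

nonSquare⇒D≢0 : ∀ d {R} → ¬ IsSquare R → D d R ≢ 0ℚ
nonSquare⇒D≢0 d {R} nsq D≡0 = nsq (d , x∙y⁻¹≈ε⇒x≈y (d ℚ.* d) R D≡0)
  where open Algebra.Properties.Group ℚₚ.+-0-group using (x∙y⁻¹≈ε⇒x≈y)

nonSquare⇒2R≢0 : ∀ {R} → ¬ IsSquare R → 2ℚ ℚ.* R ≢ 0ℚ
nonSquare⇒2R≢0 nsq = p≢0q≢0→pq≢0 2≢0 (nonSquare⇒≢0 nsq)

nonSquare⇒2D≢0 : ∀ d {R} → ¬ IsSquare R → 2ℚ ℚ.* D d R ≢ 0ℚ
nonSquare⇒2D≢0 d nsq = p≢0q≢0→pq≢0 2≢0 (nonSquare⇒D≢0 d nsq)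

------------------------------------------------------------------------
-- Polynomials over ℚ

-- The list (q₁ , e₁) ∷ (q₂ , e₂) ∷ … stands for q₁ Z^e₁ + q₂ Z^e₂ + ….
Poly : Set
Poly = List (ℚ × ℕ)

scale : ℚ → Poly → Poly
scale q = map (map₁ (q ℚ.*_))

-- Σ_{j=0}^{m} q j Z^(e j)
polySum : (m : ℕ) (q : ℕ → ℚ) (e : ℕ → ℕ) → Poly
polySum m q e = map (λ j → q j , e j) (upTo (suc m))

-- The second argument is never 0 below: c k j is only used with k ≥ 1 and
-- 2 j ≤ k.
ratio : ℕ → ℕ → ℚ
ratio p zero    = 0ℚ
ratio p (suc q) = + p ℚ./ suc q

c : (k j : ℕ) → ℚ
c k j = (ℚ.- 1ℚ) ^ℚ j ℚ.* ratio k (k ℕ.∸ j) ℚ.* (+ ((k ℕ.∸ j) C j) ℚ./ 1)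

F : (k : ℕ) → Poly
F k = polySum (k div 2) (c k) (λ j → k ℕ.∸ 2 ℕ.* j)

half : ℕ → ℕ
half n = (n ℕ.∸ 1) div 2

-- √D ^ n F_n(Z / √D) − 2 d D^((n-1)/2), for odd n
f : (n : ℕ) (d R : ℚ) → Poly
f n d R =
  polySum (half n) (λ j → c n j ℚ.* D d R ^ℚ j) (λ j → n ℕ.∸ 2 ℕ.* j)
  ++ (ℚ.- (2ℚ ℚ.* d ℚ.* D d R ^ℚ half n) , 0) ∷ []

-- F_{n-1}(Z / √D), for odd n
F[Z/√D] : (n : ℕ) (d R : ℚ) → ¬ IsSquare R → Poly
F[Z/√D] n d R nsq =
  polySum (half n)
    (λ j → c (n ℕ.∸ 1) j ℚ.* D d R ^ℚ[ nonSquare⇒D≢0 d nsq ] (j ℤ.⊖ half n))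
    (λ j → n ℕ.∸ 1 ℕ.∸ 2 ℕ.* j)

A : (n : ℕ) (d R : ℚ) → ¬ IsSquare R → Poly
A n d R nsq =
  scale (invℚ (2ℚ ℚ.* R) (nonSquare⇒2R≢0 nsq))
    (F[Z/√D] n d R nsq
     ++ (ℚ.- (d ÷ℚ D d R [ nonSquare⇒D≢0 d nsq ]) , 1) ∷ [])

-- i√R (−1)^((k-1)/2) F_k(Z / (i√R)), for odd k
P : (k : ℕ) (R : ℚ) → ¬ IsSquare R → Poly
P k R nsq =
  scale ((ℚ.- 1ℚ) ^ℚ half k)
    (polySum (half k)
      (λ j → c k j ℚ.* (ℚ.- R) ^ℚ[ nonSquare⇒-≢0 nsq ] (j ℤ.⊖ half k))
      (λ j → k ℕ.∸ 2 ℕ.* j))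

------------------------------------------------------------------------
-- Extension fields of ℚ

-- A Heyting field covers both discrete fields such as an algebraic closure of
-- ℚ (there _#_ is ¬ _≈_) and ℂ.  It is nontrivial because 1# # 0# always holds
-- and _#_ is irreflexive, so ι is injective and the characteristic is 0.
record Extension a ℓ₁ ℓ₂ : Set (lsuc (a ⊔ ℓ₁ ⊔ ℓ₂)) where
  field
    field′ : HeytingField a ℓ₁ ℓ₂

  open HeytingField field′ public
  module Ops = FieldOps field′
  open Ops public

  open RingMorphisms ℚ.+-*-rawRing rawRing using (IsRingHomomorphism)

  field
    ι     : ℚ → Carrier
    ι-hom : IsRingHomomorphism ι

  open IsRingHomomorphism ι-hom public
    using (⟦⟧-cong; +-homo; *-homo; 1#-homo; 0#-homo; -‿homo)

  ι-#0 : ∀ {p} → p ≢ 0ℚ → ι p # 0#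
  ι-#0 {p} p≢0 =
    unit⇒#0 (trans (sym (*-homo p⁻¹ p)) (trans (⟦⟧-cong (invℚ-inverseˡ p p≢0)) 1#-homo))
    where
    p⁻¹ = invℚ p p≢0

  eval : Poly → Carrier → Carrier
  eval []             x = 0#
  eval ((q , e) ∷ ps) x = ι q * x ^ e + eval ps x

------------------------------------------------------------------------
-- The elements u_k

module Roots {a ℓ₁ ℓ₂} (E : Extension a ℓ₁ ℓ₂)
  (n : ℕ) (d R : ℚ) (nsq : ¬ IsSquare R)
  (√R u ζ : Extension.Carrier E) (ζ-prim : Extension.IsPrimitiveRoot E n ζ)
  where

  open Extension E

  ζ^_ : ℤ → Carrier
  ζ^ z = ζ ^[ primitive⇒#0 ζ-prim ] z

  A[u] : Carrier
  A[u] = eval (A n d R nsq) u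

  uₖ : ℕ → Carrier
  uₖ k = ι ℚ.½ * u * (ζ^ (+ k) + ζ^ (ℤ.- + k))
       + ι (D d R) * A[u] * √R * (ζ^ (+ k) - ζ^ (ℤ.- + k))

  2DA[u] : Carrier
  2DA[u] = ι (2ℚ ℚ.* D d R) * A[u]

  2DA[u]#0 : A[u] # 0# → 2DA[u] # 0#
  2DA[u]#0 = x#0y#0→xy#0 (ι-#0 (nonSquare⇒2D≢0 d nsq))

  -- The two summands of the formula; the base points are u_1 and u_{n-1}.
  F-part : u # 0# → ℕ → Carrier
  F-part u#0 k = ι ℚ.½ * u * eval (F k) ((uₖ 1 + uₖ (n ℕ.∸ 1)) ÷ u [ u#0 ])

  P-part : A[u] # 0# → ℕ → Carrier
  P-part A#0 k =
    ι (D d R) * A[u]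
    * eval (P k R nsq) ((uₖ 1 - uₖ (n ℕ.∸ 1)) ÷ 2DA[u] [ 2DA[u]#0 A#0 ])

{-# OPTIONS --safe #-}

-- Put v = 2 D A(u) √R.  Waring's formula identifies f_n with V_n − 2 d D^((n−1)/2),
-- where V is the Lucas sequence V_(k+2) = Z V_(k+1) − D V_k, V_0 = 2, V_1 = Z.
-- At a zero u of f_n the norm identity for V_n and V_(n−1) gives v² = u² − 4 D, so
-- α = (u + v) / 2 and β = (u − v) / 2 lie in the field and satisfy α + β = u and
-- α β = D, without adjoining √D.  Then u_k = α ζ^k + β ζ^(−k) and V_n = α^n + β^n,
-- which shows that the u_k are zeros.  Moreover u divides α^n + β^n = 2 d D^((n−1)/2)
-- (n is odd) and v divides α^n − β^n, whose square is 4 R D^(n−1), so u and A(u) are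
-- invertible.  The formula is Waring's formula at ζ + ζ⁻¹ and at √R (ζ − ζ⁻¹).

module Submission where

open import Defs
open import Algebra.Apartness.Bundles using (module HeytingCommutativeRing)
open import Algebra.Bundles using (module CommutativeRing)
open import Algebra.Solver.Ring.AlmostCommutativeRing
  using (fromCommutativeRing; _-Raw-AlmostCommutative⟶_)
open import Data.Fin.Base using (toℕ)
open import Data.Integer.Base as ℤ using (+_)
open import Data.List.Base using ([]; _∷_; _++_; map; applyUpTo)
open import Data.Nat.Base as ℕ using (ℕ; zero; suc; s≤s; z≤n; _≤_; _<_; _∸_)
open import Data.Nat.Combinatorics using (_C_; nCk+nC[k+1]≡[n+1]C[k+1]; k>n⇒nCk≡0)
open import Data.Nat.DivMod using (m*n/n≡m; m≡m%n+[m/n]*n; m%n<n) renaming (_/_ to _div_)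
open import Data.Product.Base using (Σ; _×_; _,_; ∃-syntax)
open import Data.Rational.Base as ℚ using (ℚ; 0ℚ; 1ℚ; toℚᵘ)
open import Data.Rational.Unnormalised.Base as ℚᵘ using (mkℚᵘ; *≡*)
open import Relation.Binary.Consequences using (dec⇒weaklyDec)
open import Relation.Binary.PropositionalEquality as ≡ using (_≡_; _≢_; cong; cong₂)
open import Relation.Nullary.Decidable using (yes; no)
open import Relation.Nullary.Negation using (¬_)
import Algebra.Properties.CommutativeSemiring.Exp
import Algebra.Properties.Group
import Algebra.Properties.Semiring.Sum
import Algebra.Solver.Ring
import Data.Integer.Properties as ℤₚ
import Data.Maybe.Base as Maybe
import Data.Nat.Properties as ℕₚ
import Data.Nat.Solver as ℕSolver
import Data.Rational.Properties as ℚₚ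
import Data.Rational.Solver as ℚSolver
import Data.Rational.Unnormalised.Properties as ℚᵘₚ
import Relation.Binary.Reasoning.Setoid

open FieldOps ℚₚ.heytingField using ()
  renaming ( inv to invℚ; inv-inverseˡ to invℚ-inverseˡ
           ; _^_ to _^ℚ_; _^[_]_ to _^ℚ[_]_; _÷_[_] to _÷ℚ_[_])

-- Binomial identities behind the coefficients of `F`.

-- Induction on `n`: Pascal's rule splits the left side, the induction hypothesis applies to both
-- halves, and Pascal's rule one row lower reassembles them.
absorption : ∀ n k → suc k ℕ.* (suc n C suc k) ≡ suc n ℕ.* (n C k)
absorption zero zero = ≡.refl
absorption zero (suc k) = ℕₚ.*-zeroʳ (suc (suc k))
absorption (suc n) zero = begin
  1 ℕ.* (suc (suc n) C 1)          ≡⟨ ℕₚ.*-identityˡ _ ⟩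
  suc (suc n) C 1                  ≡⟨ nCk+nC[k+1]≡[n+1]C[k+1] (suc n) 0 ⟨
  (suc n C 0) ℕ.+ (suc n C 1)      ≡⟨ cong (suc n C 0 ℕ.+_) (ℕₚ.*-identityˡ _) ⟨
  (suc n C 0) ℕ.+ 1 ℕ.* (suc n C 1) ≡⟨ cong (suc n C 0 ℕ.+_) (absorption n 0) ⟩
  suc (suc n) ℕ.* 1                ∎
  where open ≡.≡-Reasoning
absorption (suc n) (suc k) = begin
  suc (suc k) ℕ.* (suc (suc n) C suc (suc k))
    ≡⟨ cong (suc (suc k) ℕ.*_) (nCk+nC[k+1]≡[n+1]C[k+1] (suc n) (suc k)) ⟨
  suc (suc k) ℕ.* (x ℕ.+ y)
    ≡⟨ ℕₚ.*-distribˡ-+ (suc (suc k)) x y ⟩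
  x ℕ.+ suc k ℕ.* x ℕ.+ suc (suc k) ℕ.* y
    ≡⟨ cong₂ (λ a b → x ℕ.+ a ℕ.+ b) (absorption n k) (absorption n (suc k)) ⟩
  x ℕ.+ suc n ℕ.* (n C k) ℕ.+ suc n ℕ.* (n C suc k)
    ≡⟨ ℕₚ.+-assoc x _ _ ⟩
  x ℕ.+ (suc n ℕ.* (n C k) ℕ.+ suc n ℕ.* (n C suc k))
    ≡⟨ cong (x ℕ.+_) (ℕₚ.*-distribˡ-+ (suc n) (n C k) (n C suc k)) ⟨
  x ℕ.+ suc n ℕ.* ((n C k) ℕ.+ (n C suc k))
    ≡⟨ cong (λ a → x ℕ.+ suc n ℕ.* a) (nCk+nC[k+1]≡[n+1]C[k+1] n k) ⟩
  suc (suc n) ℕ.* x ∎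
  where
  open ≡.≡-Reasoning
  x = suc n C suc k
  y = suc n C suc (suc k)

-- ∣ c (1 + i + j) j ∣
lucas : ℕ → ℕ → ℕ
lucas i zero    = 1
lucas i (suc j) = (suc i C suc j) ℕ.+ (i C j)

-- Clears the denominator in `c`. With k = 1 + i + j one has k - j = 1 + i, and the summand j of k
-- is absorbed into the binomial, so k/(k-j) times the binomial is a natural number.
lucas-ratio : ∀ i j → (suc i ℕ.+ j) ℕ.* (suc i C j) ≡ suc i ℕ.* lucas i j
lucas-ratio i zero    = cong (ℕ._* 1) (ℕₚ.+-identityʳ (suc i))
lucas-ratio i (suc j) = begin
  (suc i ℕ.+ suc j) ℕ.* x            ≡⟨ ℕₚ.*-distribʳ-+ x (suc i) (suc j) ⟩
  suc i ℕ.* x ℕ.+ suc j ℕ.* x        ≡⟨ cong (suc i ℕ.* x ℕ.+_) (absorption i j) ⟩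
  suc i ℕ.* x ℕ.+ suc i ℕ.* (i C j)  ≡⟨ ℕₚ.*-distribˡ-+ (suc i) x (i C j) ⟨
  suc i ℕ.* lucas i (suc j)          ∎
  where
  open ≡.≡-Reasoning
  x = suc i C suc j

-- Pascal's rule for both binomials of `lucas`. The column `j` = 0 is separate because `lucas i 0`
-- is set to 1 directly.
lucas-step : ∀ i j → lucas (suc i) (suc j) ≡ lucas i (suc j) ℕ.+ lucas i j
lucas-step i zero = begin
  (suc (suc i) C 1) ℕ.+ 1
    ≡⟨ cong (ℕ._+ 1) (nCk+nC[k+1]≡[n+1]C[k+1] (suc i) 0) ⟨
  1 ℕ.+ (suc i C 1) ℕ.+ 1
    ≡⟨ cong (ℕ._+ 1) (ℕₚ.+-comm 1 (suc i C 1)) ⟩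
  (suc i C 1) ℕ.+ 1 ℕ.+ 1 ∎
  where open ≡.≡-Reasoning
lucas-step i (suc j) = begin
  (suc (suc i) C suc (suc j)) ℕ.+ (suc i C suc j)
    ≡⟨ cong₂ ℕ._+_ (nCk+nC[k+1]≡[n+1]C[k+1] (suc i) (suc j))
                   (nCk+nC[k+1]≡[n+1]C[k+1] i j) ⟨
  ((suc i C suc j) ℕ.+ (suc i C suc (suc j))) ℕ.+ ((i C j) ℕ.+ (i C suc j))
    ≡⟨ solve 4 (λ a b c d → (a :+ b) :+ (c :+ d) := (b :+ d) :+ (a :+ c)) ≡.refl
         (suc i C suc j) (suc i C suc (suc j)) (i C j) (i C suc j) ⟩
  lucas i (suc (suc j)) ℕ.+ lucas i (suc j) ∎
  where
  open ≡.≡-Reasoning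
  open ℕSolver.+-*-Solver

-- The rational coefficients `c` and their recurrence.

fromℕ : ℕ → ℚ
fromℕ n = + n ℚ./ 1

fromℕ-+ : ∀ m n → fromℕ (m ℕ.+ n) ≡ fromℕ m ℚ.+ fromℕ n
fromℕ-+ m n = ℚₚ.toℚᵘ-injective (begin
  toℚᵘ (fromℕ (m ℕ.+ n))               ≈⟨ ℚₚ.toℚᵘ-fromℚᵘ (mkℚᵘ (+ (m ℕ.+ n)) 0) ⟩
  mkℚᵘ (+ (m ℕ.+ n)) 0                 ≈⟨ *≡* (cong (ℤ._* + 1) (≡.sym (cong₂ ℤ._+_ (ℤₚ.*-identityʳ (+ m)) (ℤₚ.*-identityʳ (+ n))))) ⟩
  mkℚᵘ (+ m) 0 ℚᵘ.+ mkℚᵘ (+ n) 0       ≈⟨ ℚᵘₚ.+-cong (ℚₚ.toℚᵘ-fromℚᵘ (mkℚᵘ (+ m) 0)) (ℚₚ.toℚᵘ-fromℚᵘ (mkℚᵘ (+ n) 0)) ⟨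
  toℚᵘ (fromℕ m) ℚᵘ.+ toℚᵘ (fromℕ n)   ≈⟨ ℚₚ.toℚᵘ-homo-+ (fromℕ m) (fromℕ n) ⟨
  toℚᵘ (fromℕ m ℚ.+ fromℕ n)           ∎)
  where open ℚᵘₚ.≃-Reasoning

-- Division in ℚ normalises and is stuck on variables. In the unnormalised rationals the claim is a
-- cross multiplication of integers.
ratio-* : ∀ p q m n → p ℕ.* m ≡ suc q ℕ.* n → ratio p (suc q) ℚ.* fromℕ m ≡ fromℕ n
ratio-* p q m n pm≡qn = ℚₚ.toℚᵘ-injective (begin
  toℚᵘ (ratio p (suc q) ℚ.* fromℕ m)
    ≈⟨ ℚₚ.toℚᵘ-homo-* (ratio p (suc q)) (fromℕ m) ⟩
  toℚᵘ (ratio p (suc q)) ℚᵘ.* toℚᵘ (fromℕ m)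
    ≈⟨ ℚᵘₚ.*-cong (ℚₚ.toℚᵘ-fromℚᵘ (mkℚᵘ (+ p) q)) (ℚₚ.toℚᵘ-fromℚᵘ (mkℚᵘ (+ m) 0)) ⟩
  mkℚᵘ (+ p) q ℚᵘ.* mkℚᵘ (+ m) 0
    ≈⟨ *≡* cross ⟩
  mkℚᵘ (+ n) 0
    ≈⟨ ℚₚ.toℚᵘ-fromℚᵘ (mkℚᵘ (+ n) 0) ⟨
  toℚᵘ (fromℕ n) ∎)
  where
  open ℚᵘₚ.≃-Reasoning
  cross : (+ p ℤ.* + m) ℤ.* + 1 ≡ + n ℤ.* + (suc q ℕ.* 1)
  cross =
    ≡.trans (ℤₚ.*-identityʳ (+ p ℤ.* + m)) (
    ≡.trans (≡.sym (ℤₚ.pos-* p m)) (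
    ≡.trans (cong +_ (≡.trans pm≡qn (ℕₚ.*-comm (suc q) n))) (
    ≡.trans (ℤₚ.pos-* n (suc q)) (
    cong (λ x → + n ℤ.* + x) (≡.sym (ℕₚ.*-identityʳ (suc q)))))))

-- Writing k as `suc i + j` turns the truncated `k ∸ j` into a successor, so that `ratio` computes
-- to an actual quotient.
c-lucas : ∀ i j → c (suc i ℕ.+ j) j ≡ (ℚ.- 1ℚ) ^ℚ j ℚ.* fromℕ (lucas i j)
c-lucas i j rewrite ℕₚ.m+n∸n≡m (suc i) j = ≡.trans
  (ℚₚ.*-assoc ((ℚ.- 1ℚ) ^ℚ j) (ratio (suc i ℕ.+ j) (suc i)) (fromℕ (suc i C j)))
  (cong ((ℚ.- 1ℚ) ^ℚ j ℚ.*_) (ratio-* (suc i ℕ.+ j) i (suc i C j) (lucas i j) (lucas-ratio i j)))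

c-zero : ∀ k → c (suc k) 0 ≡ 1ℚ
c-zero k = ≡.subst (λ m → c m 0 ≡ 1ℚ) (ℕₚ.+-identityʳ (suc k)) (c-lucas k 0)

-- Here k - j < j, so the binomial is 0. Hence a sum of the `c k j` may run past ⌊k/2⌋, and exact
-- upper limits never have to be matched.
c-vanish : ∀ k j → k ℕ.< 2 ℕ.* j → c k j ≡ 0ℚ
c-vanish k (suc j) k<2j = ≡.trans
  (cong (λ m → (ℚ.- 1ℚ) ^ℚ suc j ℚ.* ratio k (k ℕ.∸ suc j) ℚ.* fromℕ m)
    (k>n⇒nCk≡0 (ℕₚ.m<n+o⇒m∸n<o k (suc j)
      (≡.subst (λ m → k ℕ.< suc j ℕ.+ m) (ℕₚ.+-identityʳ (suc j)) k<2j))))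
  (ℚₚ.*-zeroʳ ((ℚ.- 1ℚ) ^ℚ suc j ℚ.* ratio k (k ℕ.∸ suc j)))

2m≤1+n⇒m≤n : ∀ {n} m → 2 ℕ.* m ℕ.≤ suc n → m ℕ.≤ n
2m≤1+n⇒m≤n zero    _         = z≤n
2m≤1+n⇒m≤n (suc m) (s≤s m+≤) =
  ℕₚ.≤-trans (ℕₚ.m≤m+n (suc m) 0) (ℕₚ.≤-trans (ℕₚ.m≤n+m (suc m ℕ.+ 0) m) m+≤)

-- The recurrence starts at index 1, since c 0 0 = 0 (and not 2).
c-step : ∀ k j → c (3 ℕ.+ k) (suc j) ≡ c (2 ℕ.+ k) (suc j) ℚ.- c (suc k) j
c-step k j with suc k ℕₚ.<? 2 ℕ.* j
-- Beyond the range of the sum all three coefficients vanish.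
... | yes k<2j = begin
  c (3 ℕ.+ k) (suc j)                    ≡⟨ c-vanish (3 ℕ.+ k) (suc j) (2+< k<2j) ⟩
  0ℚ                                     ≡⟨ cong₂ ℚ._-_ (c-vanish (2 ℕ.+ k) (suc j) (ℕₚ.<-trans (ℕₚ.n<1+n _) (2+< k<2j))) (c-vanish (suc k) j k<2j) ⟨
  c (2 ℕ.+ k) (suc j) ℚ.- c (suc k) j    ∎
  where
  open ≡.≡-Reasoning
  2+< : ∀ {m} → m ℕ.< 2 ℕ.* j → 2 ℕ.+ m ℕ.< 2 ℕ.* suc j
  2+< {m} m<2j = ≡.subst (2 ℕ.+ m ℕ.<_) (≡.sym (ℕₚ.*-suc 2 j)) (s≤s (s≤s m<2j))
-- Now j ≤ k, and `suc k` is `suc i + j`, so `c-lucas` applies to all three coefficients. The minus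
-- sign comes from (-1)^(j+1) against (-1)^j.
... | no k≮2j = ≡.subst
  (λ m → c (2 ℕ.+ m) (suc j) ≡ c (suc m) (suc j) ℚ.- c m j) i+j≡k (begin
  c (2 ℕ.+ (suc i ℕ.+ j)) (suc j)
    ≡⟨ cong (λ m → c (suc (suc m)) (suc j)) (ℕₚ.+-suc i j) ⟨
  c (suc (suc i) ℕ.+ suc j) (suc j)
    ≡⟨ c-lucas (suc i) (suc j) ⟩
  ℚ.- 1ℚ ℚ.* s ℚ.* fromℕ (lucas (suc i) (suc j))
    ≡⟨ cong (ℚ.- 1ℚ ℚ.* s ℚ.*_) (≡.trans (cong fromℕ (lucas-step i j)) (fromℕ-+ (lucas i (suc j)) (lucas i j))) ⟩
  ℚ.- 1ℚ ℚ.* s ℚ.* (fromℕ (lucas i (suc j)) ℚ.+ fromℕ (lucas i j))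
    ≡⟨ solve 3 (λ s a b → con (ℚ.- 1ℚ) :* s :* (a :+ b) := con (ℚ.- 1ℚ) :* s :* a :- s :* b)
         ≡.refl s (fromℕ (lucas i (suc j))) (fromℕ (lucas i j)) ⟩
  ℚ.- 1ℚ ℚ.* s ℚ.* fromℕ (lucas i (suc j)) ℚ.- s ℚ.* fromℕ (lucas i j)
    ≡⟨ cong₂ ℚ._-_ (c-lucas i (suc j)) (c-lucas i j) ⟨
  c (suc i ℕ.+ suc j) (suc j) ℚ.- c (suc i ℕ.+ j) j
    ≡⟨ cong (λ m → c (suc m) (suc j) ℚ.- c (suc i ℕ.+ j) j) (ℕₚ.+-suc i j) ⟩
  c (suc (suc i ℕ.+ j)) (suc j) ℚ.- c (suc i ℕ.+ j) j ∎)
  where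
  open ≡.≡-Reasoning
  open ℚSolver.+-*-Solver
  i = k ℕ.∸ j
  i+j≡k : suc i ℕ.+ j ≡ suc k
  i+j≡k = cong suc (ℕₚ.m∸n+n≡m (2m≤1+n⇒m≤n j (ℕₚ.≮⇒≥ k≮2j)))
  s = (ℚ.- 1ℚ) ^ℚ j

-- Halves of odd numbers, summation bounds and integer powers.

odd-half : ∀ n → Odd n → n ≡ suc (half n ℕ.* 2)
odd-half n odd = let m , n≡1+2m = go n odd in
  ≡.trans n≡1+2m (cong (λ x → suc (x ℕ.* 2))
    (≡.sym (≡.trans (cong half n≡1+2m) (m*n/n≡m m 2))))
  where
  go : ∀ n → Odd n → ∃[ m ] n ≡ suc (m ℕ.* 2)
  go (suc zero)    _   = 0 , ≡.refl
  go (suc (suc n)) odd = let m , n≡ = go n odd in suc m , cong (λ x → suc (suc x)) n≡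

-- The bound that `waring` asks for: a sum over 0 ≤ j ≤ (n-1)/2 misses only vanishing terms.
odd⇒<2*suc-half : ∀ n → Odd n → n ℕ.< 2 ℕ.* suc (half n)
odd⇒<2*suc-half n odd = ≡.subst₂ ℕ._<_ (≡.sym (odd-half n odd)) (ℕₚ.*-comm (suc (half n)) 2) ℕₚ.≤-refl

n<2*suc[n/2] : ∀ n → n ℕ.< 2 ℕ.* suc (n div 2)
n<2*suc[n/2] n = ≡.subst₂ ℕ._<_ (≡.sym (m≡m%n+[m/n]*n n 2)) (ℕₚ.*-comm (suc (n div 2)) 2)
  (ℕₚ.+-monoˡ-< (n div 2 ℕ.* 2) (m%n<n n 2))

-- Splits off the factor q^(-h), which does not depend on the summation index `j` and can leave the
-- sums in `F[Z/√D]` and `P`.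
^ℚ-⊖ : ∀ q (q≢0 : q ≢ 0ℚ) j h →
       q ^ℚ[ q≢0 ] (j ℤ.⊖ h) ≡ q ^ℚ j ℚ.* invℚ q q≢0 ^ℚ h
^ℚ-⊖ q q≢0 zero    zero    = ≡.refl
^ℚ-⊖ q q≢0 zero    (suc h) = ≡.sym (ℚₚ.*-identityˡ _)
^ℚ-⊖ q q≢0 (suc j) zero    = ≡.sym (ℚₚ.*-identityʳ _)
^ℚ-⊖ q q≢0 (suc j) (suc h) = begin
  q ^ℚ[ q≢0 ] (suc j ℤ.⊖ suc h)
    ≡⟨ cong (q ^ℚ[ q≢0 ]_) (ℤₚ.[1+m]⊖[1+n]≡m⊖n j h) ⟩
  q ^ℚ[ q≢0 ] (j ℤ.⊖ h)
    ≡⟨ ^ℚ-⊖ q q≢0 j h ⟩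
  q ^ℚ j ℚ.* q⁻¹ ^ℚ h
    ≡⟨ ℚₚ.*-identityˡ (q ^ℚ j ℚ.* q⁻¹ ^ℚ h) ⟨
  1ℚ ℚ.* (q ^ℚ j ℚ.* q⁻¹ ^ℚ h)
    ≡⟨ cong (ℚ._* (q ^ℚ j ℚ.* q⁻¹ ^ℚ h)) (invℚ-inverseˡ q q≢0) ⟨
  q⁻¹ ℚ.* q ℚ.* (q ^ℚ j ℚ.* q⁻¹ ^ℚ h)
    ≡⟨ solve 4 (λ q r a b → r :* q :* (a :* b) := q :* a :* (r :* b))
         ≡.refl q q⁻¹ (q ^ℚ j) (q⁻¹ ^ℚ h) ⟩
  q ^ℚ suc j ℚ.* q⁻¹ ^ℚ suc h ∎
  where
  open ≡.≡-Reasoning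
  open ℚSolver.+-*-Solver
  q⁻¹ = invℚ q q≢0

-- Arithmetic in the extension field.

module ExtensionProperties {a ℓ₁ ℓ₂} (E : Extension a ℓ₁ ℓ₂) where

  open Extension E

  open HeytingCommutativeRing heytingCommutativeRing using () renaming (commutativeRing to ring)
  open CommutativeRing ring public using (commutativeSemiring)
  open Algebra.Properties.CommutativeSemiring.Exp commutativeSemiring public
    using (^-distrib-*; ^-assocʳ; ^-congˡ; ^-congʳ; ^-homo-*)
  open Algebra.Properties.Semiring.Sum semiring public using (sum; *-distribˡ-sum; sum-cong-≋; ∑-distrib-+)
  open Algebra.Properties.Group (CommutativeRing.+-group ring) public
    using () renaming (x∙y⁻¹≈ε⇒x≈y to x-y≈0⇒x≈y)
  open Relation.Binary.Reasoning.Setoid setoid public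

  -- Lets the ring solver take its coefficients from ℚ, so that identities with the constants ½, 2
  -- and 4 are decided by rational arithmetic.
  ι-morphism : ℚ.+-*-rawRing -Raw-AlmostCommutative⟶ fromCommutativeRing ring
  ι-morphism = record
    { ⟦_⟧    = ι
    ; +-homo = +-homo
    ; *-homo = *-homo
    ; -‿homo = -‿homo
    ; 0-homo = 0#-homo
    ; 1-homo = 1#-homo
    }

  open Algebra.Solver.Ring ℚ.+-*-rawRing (fromCommutativeRing ring) ι-morphism
    (λ p q → Maybe.map ⟦⟧-cong (dec⇒weaklyDec ℚₚ._≟_ p q)) public
    using (solve; _:=_; _:+_; _:*_; _:-_; :-_; con)

  4ℚ = 2ℚ ℚ.* 2ℚ

  ι-minus : ∀ p q → ι (p ℚ.- q) ≈ ι p - ι q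
  ι-minus p q = trans (+-homo p (ℚ.- q)) (+-congˡ (-‿homo q))

  ι-^ : ∀ q n → ι (q ^ℚ n) ≈ ι q ^ n
  ι-^ q zero    = 1#-homo
  ι-^ q (suc n) = trans (*-homo q (q ^ℚ n)) (*-congˡ (ι-^ q n))

  -- Lucas sequences and Waring's formula.

  module Lucas (p q : Carrier) where

    -- For k ≥ 1 this is √q^k F_k(p/√q), in a form that makes sense without a square root of `q`.
    V : ℕ → Carrier
    V zero          = ι 2ℚ
    V (suc zero)    = p
    V (suc (suc k)) = p * V (suc k) - q * V k

    term : ℕ → ℕ → Carrier
    term k j = ι (c k j) * q ^ j * p ^ (k ℕ.∸ 2 ℕ.* j)

    term-zero : ∀ k → term (suc k) 0 ≈ p ^ suc k
    term-zero k = begin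
      ι (c (suc k) 0) * 1# * p ^ suc k ≈⟨ *-congʳ (*-identityʳ _) ⟩
      ι (c (suc k) 0) * p ^ suc k      ≈⟨ *-congʳ (trans (⟦⟧-cong (c-zero k)) 1#-homo) ⟩
      1# * p ^ suc k                   ≈⟨ *-identityˡ _ ⟩
      p ^ suc k                        ∎

    term-vanish : ∀ k j → k ℕ.< 2 ℕ.* j → term k j ≈ 0#
    term-vanish k j k<2j = begin
      ι (c k j) * q ^ j * p ^ (k ℕ.∸ 2 ℕ.* j)
        ≈⟨ *-congʳ (*-congʳ (trans (⟦⟧-cong (c-vanish k j k<2j)) 0#-homo)) ⟩
      0# * q ^ j * p ^ (k ℕ.∸ 2 ℕ.* j)
        ≈⟨ *-congʳ (zeroˡ _) ⟩
      0# * p ^ (k ℕ.∸ 2 ℕ.* j)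
        ≈⟨ zeroˡ _ ⟩
      0# ∎

    ∸-2*suc : ∀ k j → suc (suc k) ℕ.∸ 2 ℕ.* suc j ≡ k ℕ.∸ 2 ℕ.* j
    ∸-2*suc k j = cong (suc (suc k) ℕ.∸_) (ℕₚ.*-suc 2 j)

    -- `c-step` multiplied by the powers of `q` and `p`. The only care needed is with the truncated
    -- exponent of `p`.
    term-step : ∀ k j → term (3 ℕ.+ k) (suc j) ≈ p * term (2 ℕ.+ k) (suc j) - q * term (suc k) j
    term-step k j = begin
      ι (c (3 ℕ.+ k) (suc j)) * (q * q ^ j) * p ^ (3 ℕ.+ k ℕ.∸ 2 ℕ.* suc j)
        ≈⟨ *-cong (*-congʳ (trans (⟦⟧-cong (c-step k j)) (ι-minus _ _))) (^-congʳ p (∸-2*suc (suc k) j)) ⟩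
      (c₁ - c₀) * (q * q ^ j) * p ^ (suc k ℕ.∸ 2 ℕ.* j)
        ≈⟨ solve 5 (λ c₁ c₀ q qʲ pᵐ → (c₁ :- c₀) :* (q :* qʲ) :* pᵐ
             := c₁ :* (q :* qʲ) :* pᵐ :- q :* (c₀ :* qʲ :* pᵐ))
             refl c₁ c₀ q (q ^ j) (p ^ (suc k ℕ.∸ 2 ℕ.* j)) ⟩
      c₁ * (q * q ^ j) * p ^ (suc k ℕ.∸ 2 ℕ.* j) - q * term (suc k) j
        ≈⟨ +-congʳ first ⟩
      p * term (2 ℕ.+ k) (suc j) - q * term (suc k) j ∎
      where
      c₁ = ι (c (2 ℕ.+ k) (suc j))
      c₀ = ι (c (suc k) j)
      first : c₁ * (q * q ^ j) * p ^ (suc k ℕ.∸ 2 ℕ.* j) ≈ p * term (2 ℕ.+ k) (suc j)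
      -- Pulling out one factor `p` lowers the exponent only while 2j ≤ k. Past that point
      -- truncation breaks the exponents, but the coefficient is already 0.
      first with 2 ℕ.* j ℕₚ.≤? k
      ... | yes 2j≤k = begin
        c₁ * (q * q ^ j) * p ^ (suc k ℕ.∸ 2 ℕ.* j)
          ≈⟨ *-congˡ (^-congʳ p (ℕₚ.+-∸-assoc 1 2j≤k)) ⟩
        c₁ * (q * q ^ j) * (p * p ^ (k ℕ.∸ 2 ℕ.* j))
          ≈⟨ solve 3 (λ x p y → x :* (p :* y) := p :* (x :* y))
               refl (c₁ * (q * q ^ j)) p (p ^ (k ℕ.∸ 2 ℕ.* j)) ⟩
        p * (c₁ * (q * q ^ j) * p ^ (k ℕ.∸ 2 ℕ.* j))
          ≈⟨ *-congˡ (*-congˡ (^-congʳ p (∸-2*suc k j))) ⟨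
        p * term (2 ℕ.+ k) (suc j) ∎
      ... | no 2j≰k = begin
        c₁ * (q * q ^ j) * p ^ (suc k ℕ.∸ 2 ℕ.* j)
          ≈⟨ *-congʳ (*-congʳ (trans (⟦⟧-cong (c-vanish (2 ℕ.+ k) (suc j) big)) 0#-homo)) ⟩
        0# * (q * q ^ j) * p ^ (suc k ℕ.∸ 2 ℕ.* j)
          ≈⟨ trans (*-congʳ (zeroˡ _)) (zeroˡ _) ⟩
        0#
          ≈⟨ trans (*-congˡ (term-vanish (2 ℕ.+ k) (suc j) big)) (zeroʳ p) ⟨
        p * term (2 ℕ.+ k) (suc j) ∎
        where
        big : 2 ℕ.+ k ℕ.< 2 ℕ.* suc j
        big = ≡.subst (2 ℕ.+ k ℕ.<_) (≡.sym (ℕₚ.*-suc 2 j)) (s≤s (s≤s (ℕₚ.≰⇒> 2j≰k)))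

    sum-zero : ∀ N {g : ℕ → Carrier} → (∀ j → g j ≈ 0#) → sum {N} (λ i → g (toℕ i)) ≈ 0#
    sum-zero zero    g≈0 = refl
    sum-zero (suc N) g≈0 = trans (+-cong (g≈0 0) (sum-zero N (λ j → g≈0 (suc j)))) (+-identityˡ 0#)

    -- Summing `term-step` over j gives the recurrence of `V`. Leaving `N` free lets the induction
    -- use sums of different lengths, and the index starts at 1 because `c 0 0` is not 2.
    waring : ∀ k N → suc k ℕ.< 2 ℕ.* N → sum {N} (λ i → term (suc k) (toℕ i)) ≈ V (suc k)
    waring zero (suc N) _ = begin
      term 1 0 + sum {N} (λ i → term 1 (suc (toℕ i)))
        ≈⟨ +-cong (term-zero 0) (sum-zero N (λ j → term-vanish 1 (suc j) (≡.subst (1 ℕ.<_) (≡.sym (ℕₚ.*-suc 2 j)) (s≤s (s≤s z≤n))))) ⟩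
      p * 1# + 0#
        ≈⟨ trans (+-identityʳ _) (*-identityʳ p) ⟩
      p ∎
    waring (suc zero) (suc zero) (s≤s (s≤s ()))
    waring (suc zero) (suc (suc N)) _ = begin
      term 2 0 + (term 2 1 + sum {N} (λ i → term 2 (suc (suc (toℕ i)))))
        ≈⟨ +-cong (term-zero 1) (+-congˡ (sum-zero N (λ j → term-vanish 2 (suc (suc j)) (≡.subst (2 ℕ.<_) (≡.sym (≡.trans (ℕₚ.*-suc 2 (suc j)) (cong (2 ℕ.+_) (ℕₚ.*-suc 2 j)))) (s≤s (s≤s (s≤s z≤n))))))) ⟩
      -- `c 2 1` computes to -2, which accounts for the initial value `V 0` = 2.
      p * (p * 1#) + (ι (ℚ.- 2ℚ) * (q * 1#) * 1# + 0#)
        ≈⟨ +-cong (*-congˡ (*-identityʳ p)) (trans (+-identityʳ _) (trans (*-identityʳ _) (*-congˡ (*-identityʳ q)))) ⟩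
      p * p + ι (ℚ.- 2ℚ) * q
        ≈⟨ solve 2 (λ p q → p :* p :+ con (ℚ.- 2ℚ) :* q := p :* p :- q :* con 2ℚ) refl p q ⟩
      p * p - q * ι 2ℚ ∎
    waring (suc (suc k)) (suc N) k<N = begin
      term (3 ℕ.+ k) 0 + sum {N} (λ i → term (3 ℕ.+ k) (suc (toℕ i)))
        ≈⟨ +-cong (trans (term-zero (2 ℕ.+ k)) (*-congˡ (sym (term-zero (suc k)))))
             (sum-cong-≋ {N} (λ i → term-step k (toℕ i))) ⟩
      p * t₀ + sum {N} (λ i → p * t₁ i + - (q * t₂ i))
        ≈⟨ +-congˡ (sum-cong-≋ {N} (λ i → +-congˡ (solve 2 (λ q t → :- (q :* t) := :- q :* t)
             refl q (t₂ i)))) ⟩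
      p * t₀ + sum {N} (λ i → p * t₁ i + - q * t₂ i)
        ≈⟨ +-congˡ (∑-distrib-+ (λ i → p * t₁ i) (λ i → - q * t₂ i)) ⟩
      p * t₀ + (sum {N} (λ i → p * t₁ i) + sum {N} (λ i → - q * t₂ i))
        ≈⟨ +-congˡ (+-cong (*-distribˡ-sum p t₁) (*-distribˡ-sum (- q) t₂)) ⟨
      p * t₀ + (p * sum t₁ + - q * sum t₂)
        ≈⟨ solve 5 (λ p q t x y → p :* t :+ (p :* x :+ :- q :* y) := p :* (t :+ x) :- q :* y)
             refl p q t₀ (sum t₁) (sum t₂) ⟩
      p * (t₀ + sum t₁) - q * sum t₂
        -- The index lower by one keeps all `suc N` summands. The index lower by two has only `N` of
        -- them, because the shift of j removes one, and its bound drops by 2 on both sides.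
        ≈⟨ +-cong (*-congˡ (waring (suc k) (suc N) (ℕₚ.<-trans (ℕₚ.n<1+n _) k<N)))
                  (-‿cong (*-congˡ (waring k N (ℕ.s≤s⁻¹ (ℕ.s≤s⁻¹ (≡.subst (4 ℕ.+ k ℕ.≤_) (ℕₚ.*-suc 2 N) k<N)))))) ⟩
      p * V (2 ℕ.+ k) - q * V (suc k) ∎
      where
      t₀ = term (2 ℕ.+ k) 0
      t₁ = λ i → term (2 ℕ.+ k) (suc (toℕ {N} i))
      t₂ = λ i → term (suc k) (toℕ {N} i)

    -- X² - pXY + qY² is the norm of X - xY for a zero x of Z² - pZ + q. One step of the recurrence
    -- multiplies V_(k+1) - x V_k by the other zero, hence the norm by `q`.
    V-norm : ∀ k → V (suc k) * V (suc k) - p * V (suc k) * V k + q * (V k * V k)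
                   ≈ (ι 4ℚ * q - p * p) * q ^ k
    V-norm zero = begin
      p * p - p * p * ι 2ℚ + q * (ι 2ℚ * ι 2ℚ)
        ≈⟨ solve 2 (λ p q → p :* p :- p :* p :* con 2ℚ :+ q :* (con 2ℚ :* con 2ℚ)
             := con 4ℚ :* q :- p :* p)
             refl p q ⟩
      ι 4ℚ * q - p * p
        ≈⟨ *-identityʳ _ ⟨
      (ι 4ℚ * q - p * p) * 1# ∎
    V-norm (suc k) = begin
      (p * x - q * y) * (p * x - q * y) - p * (p * x - q * y) * x + q * (x * x)
        ≈⟨ solve 4 (λ p q x y → (p :* x :- q :* y) :* (p :* x :- q :* y) :- p :* (p :* x :- q :* y) :* x :+ q :* (x :* x)
             := q :* (x :* x :- p :* x :* y :+ q :* (y :* y))) refl p q x y ⟩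
      q * (x * x - p * x * y + q * (y * y))
        ≈⟨ *-congˡ (V-norm k) ⟩
      q * ((ι 4ℚ * q - p * p) * q ^ k)
        ≈⟨ solve 3 (λ q x y → q :* (x :* y) := x :* (q :* y)) refl q (ι 4ℚ * q - p * p) (q ^ k) ⟩
      (ι 4ℚ * q - p * p) * (q * q ^ k) ∎
      where
      x = V (suc k)
      y = V k

    -- Modulo `p` the recurrence reads V_(k+2) ≡ -q V_k, and V_1 = p starts the odd indices.
    V-odd : ∀ m → ∃[ w ] V (suc (m ℕ.* 2)) ≈ w * p
    V-odd zero    = 1# , sym (*-identityˡ p)
    V-odd (suc m) = let w , V≈wp = V-odd m in
      V (2 ℕ.+ m ℕ.* 2) - q * w , (begin
      p * V (2 ℕ.+ m ℕ.* 2) - q * V (suc (m ℕ.* 2))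
        ≈⟨ +-congˡ (-‿cong (*-congˡ V≈wp)) ⟩
      p * V (2 ℕ.+ m ℕ.* 2) - q * (w * p)
        ≈⟨ solve 4 (λ p q v w → p :* v :- q :* (w :* p) := (v :- q :* w) :* p)
             refl p q (V (2 ℕ.+ m ℕ.* 2)) w ⟩
      (V (2 ℕ.+ m ℕ.* 2) - q * w) * p ∎)

    -- `x` and `y` are zeros of Z² - pZ + q, so their powers obey the recurrence.
    V-closed : ∀ {x y} → p ≈ x + y → q ≈ x * y → ∀ k → V k ≈ x ^ k + y ^ k
    V-closed p≈ q≈ zero          = trans (+-homo 1ℚ 1ℚ) (+-cong 1#-homo 1#-homo)
    V-closed {x} {y} p≈ q≈ (suc zero) = trans p≈ (sym (+-cong (*-identityʳ x) (*-identityʳ y)))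
    V-closed {x} {y} p≈ q≈ (suc (suc k)) = begin
      p * V (suc k) - q * V k
        ≈⟨ +-cong (*-cong p≈ (V-closed p≈ q≈ (suc k))) (-‿cong (*-cong q≈ (V-closed p≈ q≈ k))) ⟩
      (x + y) * (x * x ^ k + y * y ^ k) - x * y * (x ^ k + y ^ k)
        ≈⟨ solve 4 (λ x y a b → (x :+ y) :* (x :* a :+ y :* b) :- x :* y :* (a :+ b)
             := x :* (x :* a) :+ y :* (y :* b))
             refl x y (x ^ k) (y ^ k) ⟩
      x * (x * x ^ k) + y * (y * y ^ k) ∎

  open Lucas public using (V; V-norm; V-odd; V-closed)

  -- For `α` and `β` this exhibits α - β, and with it A(u), as a factor of α^n - β^n.
  ^-diff-factor : ∀ x y n → ∃[ t ] x ^ n - y ^ n ≈ t * (x - y)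
  ^-diff-factor x y zero    = 0# , trans (-‿inverseʳ 1#) (sym (zeroˡ _))
  ^-diff-factor x y (suc n) = let t , eq = ^-diff-factor x y n in
    x ^ n + t * y , (begin
    x * x ^ n - y * y ^ n
      ≈⟨ solve 4 (λ x y a b → x :* a :- y :* b := a :* (x :- y) :+ (a :- b) :* y)
           refl x y (x ^ n) (y ^ n) ⟩
    x ^ n * (x - y) + (x ^ n - y ^ n) * y
      ≈⟨ +-congˡ (*-congʳ eq) ⟩
    x ^ n * (x - y) + t * (x - y) * y
      ≈⟨ solve 4 (λ x y a t → a :* (x :- y) :+ t :* (x :- y) :* y := (a :+ t :* y) :* (x :- y))
           refl x y (x ^ n) t ⟩
    (x ^ n + t * y) * (x - y) ∎)

  1^n≈1 : ∀ n → 1# ^ n ≈ 1#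
  1^n≈1 zero    = refl
  1^n≈1 (suc n) = trans (*-identityˡ _) (1^n≈1 n)

  ^-inverse : ∀ {x y} n → x * y ≈ 1# → x ^ n * y ^ n ≈ 1#
  ^-inverse {x} {y} n xy≈1 =
    trans (sym (^-distrib-* x y n)) (trans (^-congˡ n xy≈1) (1^n≈1 n))

  ^-double : ∀ x h → x ^ (h ℕ.* 2) ≈ x ^ h * x ^ h
  ^-double x h = trans (sym (^-assocʳ x h 2)) (*-congˡ (*-identityʳ _))

  -- Values of `F`, `f`, `A` and `P` in terms of Lucas sequences.

  eval-cong : ∀ ps {x y} → x ≈ y → eval ps x ≈ eval ps y
  eval-cong []             x≈y = refl
  eval-cong ((q , e) ∷ ps) x≈y = +-cong (*-congˡ (^-congˡ e x≈y)) (eval-cong ps x≈y)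

  eval-++ : ∀ ps qs x → eval (ps ++ qs) x ≈ eval ps x + eval qs x
  eval-++ []             qs x = sym (+-identityˡ _)
  eval-++ ((q , e) ∷ ps) qs x = trans (+-congˡ (eval-++ ps qs x)) (sym (+-assoc _ _ _))

  eval-scale : ∀ r ps x → eval (scale r ps) x ≈ ι r * eval ps x
  eval-scale r []             x = sym (zeroʳ _)
  eval-scale r ((q , e) ∷ ps) x = begin
    ι (r ℚ.* q) * x ^ e + eval (scale r ps) x
      ≈⟨ +-cong (trans (*-congʳ (*-homo r q)) (*-assoc _ _ _)) (eval-scale r ps x) ⟩
    ι r * (ι q * x ^ e) + ι r * eval ps x
      ≈⟨ distribˡ _ _ _ ⟨
    ι r * (ι q * x ^ e + eval ps x) ∎

  eval-monomial : ∀ q e x → eval ((q , e) ∷ []) x ≈ ι q * x ^ e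
  eval-monomial q e x = +-identityʳ _

  eval-applyUpTo : ∀ (q : ℕ → ℚ) (e g : ℕ → ℕ) N x →
    eval (map (λ j → q j , e j) (applyUpTo g N)) x ≡ sum {N} (λ i → ι (q (g (toℕ i))) * x ^ e (g (toℕ i)))
  eval-applyUpTo q e g zero    x = ≡.refl
  eval-applyUpTo q e g (suc N) x = cong (_+_ _) (eval-applyUpTo q e (λ j → g (suc j)) N x)

  -- The common shape of all polynomials involved: q = 1 and w = 1 for `F`, q = D and w = 1 for `f`,
  -- q = D and w = D^(-(n-1)/2) for `F[Z/√D]`, q = -R and w = (-R)^(-(k-1)/2) for `P` up to its
  -- sign.
  eval-polySum : ∀ M k q w (g : ℕ → ℚ) x → 1 ℕ.≤ k → k ℕ.< 2 ℕ.* suc M →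
    (∀ j → ι (g j) ≈ w * (ι (c k j) * q ^ j)) →
    eval (polySum M g (λ j → k ℕ.∸ 2 ℕ.* j)) x ≈ w * V x q k
  eval-polySum M k@(suc k-1) q w g x _ k<2+2M g≈ = begin
    eval (polySum M g (λ j → k ℕ.∸ 2 ℕ.* j)) x
      ≈⟨ reflexive (eval-applyUpTo g _ (λ j → j) (suc M) x) ⟩
    sum {suc M} (λ i → ι (g (toℕ i)) * x ^ (k ℕ.∸ 2 ℕ.* toℕ i))
      ≈⟨ sum-cong-≋ {suc M} (λ i → trans (*-congʳ (g≈ (toℕ i))) (*-assoc w _ (x ^ (k ℕ.∸ 2 ℕ.* toℕ i)))) ⟩
    sum {suc M} (λ i → w * Lucas.term x q k (toℕ i))
      ≈⟨ *-distribˡ-sum {suc M} w (λ i → Lucas.term x q k (toℕ i)) ⟨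
    w * sum {suc M} (λ i → Lucas.term x q k (toℕ i))
      ≈⟨ *-congˡ (Lucas.waring x q k-1 (suc M) k<2+2M) ⟩
    w * V x q k ∎

  ι-inverse : ∀ {p} (p≢0 : p ≢ 0ℚ) → ι p * ι (invℚ p p≢0) ≈ 1#
  ι-inverse {p} p≢0 = trans (*-comm _ _) (trans (sym (*-homo _ p)) (trans (⟦⟧-cong (invℚ-inverseˡ p p≢0)) 1#-homo))

  eval-F : ∀ k x → 1 ℕ.≤ k → eval (F k) x ≈ V x 1# k
  eval-F k x 1≤k = trans
    (eval-polySum (k div 2) k 1# 1# (c k) x 1≤k (n<2*suc[n/2] k)
      (λ j → sym (trans (*-identityˡ _) (trans (*-congˡ (1^n≈1 j)) (*-identityʳ _)))))
    (*-identityˡ _)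

  eval-polySum-⊖ : ∀ M k q (q≢0 : q ≢ 0ℚ) h x → 1 ℕ.≤ k → k ℕ.< 2 ℕ.* suc M →
    eval (polySum M (λ j → c k j ℚ.* q ^ℚ[ q≢0 ] (j ℤ.⊖ h)) (λ j → k ℕ.∸ 2 ℕ.* j)) x
      ≈ ι (invℚ q q≢0) ^ h * V x (ι q) k
  eval-polySum-⊖ M k q q≢0 h x 1≤k k< = eval-polySum M k (ι q) (ι q⁻¹ ^ h) _ x 1≤k k< λ j → begin
    ι (c k j ℚ.* q ^ℚ[ q≢0 ] (j ℤ.⊖ h))
      ≈⟨ *-homo _ _ ⟩
    ι (c k j) * ι (q ^ℚ[ q≢0 ] (j ℤ.⊖ h))
      ≈⟨ *-congˡ (trans (⟦⟧-cong (^ℚ-⊖ q q≢0 j h)) (*-homo _ _)) ⟩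
    ι (c k j) * (ι (q ^ℚ j) * ι (q⁻¹ ^ℚ h))
      ≈⟨ *-congˡ (*-cong (ι-^ q j) (ι-^ q⁻¹ h)) ⟩
    ι (c k j) * (ι q ^ j * ι q⁻¹ ^ h)
      ≈⟨ solve 3 (λ x y z → x :* (y :* z) := z :* (x :* y)) refl (ι (c k j)) (ι q ^ j) (ι q⁻¹ ^ h) ⟩
    ι q⁻¹ ^ h * (ι (c k j) * ι q ^ j) ∎
    where q⁻¹ = invℚ q q≢0

  eval-f : ∀ n d R x → Odd n → 1 ℕ.≤ n →
    eval (f n d R) x ≈ V x (ι (D d R)) n - ι 2ℚ * ι d * ι (D d R) ^ half n
  eval-f n d R x odd 1≤n = begin
    eval (f n d R) x
      ≈⟨ eval-++ (polySum (half n) (λ j → c n j ℚ.* D d R ^ℚ j) (λ j → n ℕ.∸ 2 ℕ.* j)) _ x ⟩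
    _ + eval ((ℚ.- (2ℚ ℚ.* d ℚ.* D d R ^ℚ half n) , 0) ∷ []) x
      ≈⟨ +-cong
        (trans
          (eval-polySum (half n) n (ι (D d R)) 1# _ x 1≤n (odd⇒<2*suc-half n odd)
            (λ j → trans (*-homo _ _) (trans (*-congˡ (ι-^ (D d R) j)) (sym (*-identityˡ _)))))
          (*-identityˡ _))
        (trans (eval-monomial _ 0 x) (*-identityʳ _)) ⟩
    V x (ι (D d R)) n + ι (ℚ.- (2ℚ ℚ.* d ℚ.* D d R ^ℚ half n))
      ≈⟨ +-congˡ (-‿homo _) ⟩
    V x (ι (D d R)) n - ι (2ℚ ℚ.* d ℚ.* D d R ^ℚ half n)
      ≈⟨ +-congˡ (-‿cong (trans (*-homo _ _) (*-cong (*-homo 2ℚ d) (ι-^ (D d R) (half n))))) ⟩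
    V x (ι (D d R)) n - ι 2ℚ * ι d * ι (D d R) ^ half n ∎

  eval-A : ∀ n d R nsq x → Odd n → 2 ℕ.≤ n → let e = ι (invℚ (D d R) (nonSquare⇒D≢0 d nsq)) in
    eval (A n d R nsq) x
      ≈ ι (invℚ (2ℚ ℚ.* R) (nonSquare⇒2R≢0 nsq))
        * (e ^ half n * V x (ι (D d R)) (half n ℕ.* 2) - ι d * e * x)
  eval-A n d R nsq x odd 2≤n = trans (eval-scale _ (G ++ L) x) (*-congˡ (begin
    eval (G ++ L) x
      ≈⟨ eval-++ G L x ⟩
    eval G x + eval L x
      ≈⟨ +-cong
        (eval-polySum-⊖ (half n) (n ℕ.∸ 1) (D d R) (nonSquare⇒D≢0 d nsq) (half n) x
          (ℕₚ.∸-monoˡ-≤ 1 2≤n)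
          (ℕₚ.≤-<-trans (ℕₚ.m∸n≤m n 1) (odd⇒<2*suc-half n odd)))
        (eval-monomial _ 1 x) ⟩
    e ^ half n * V x (ι (D d R)) (n ℕ.∸ 1) + ι (ℚ.- (d ÷ℚ D d R [ nonSquare⇒D≢0 d nsq ])) * (x * 1#)
      -- Replacing `n ∸ 1` by `half n * 2` makes this the neighbour of index `n` in `V-norm` and
      -- prepares the doubling of exponents.
      ≈⟨ +-cong (*-congˡ (reflexive (cong (λ m → V x (ι (D d R)) (m ℕ.∸ 1)) (odd-half n odd))))
           (*-cong (trans (-‿homo _) (-‿cong (*-homo d _))) (*-identityʳ x)) ⟩
    e ^ half n * V x (ι (D d R)) (half n ℕ.* 2) + - (ι d * e) * x
      ≈⟨ +-congˡ (solve 2 (λ x y → :- x :* y := :- (x :* y)) refl (ι d * e) x) ⟩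
    e ^ half n * V x (ι (D d R)) (half n ℕ.* 2) - ι d * e * x ∎))
    where
    G = F[Z/√D] n d R nsq
    L = (ℚ.- (d ÷ℚ D d R [ nonSquare⇒D≢0 d nsq ]) , 1) ∷ []
    e = ι (invℚ (D d R) (nonSquare⇒D≢0 d nsq))

  -^-odd : ∀ x h → (- x) ^ suc (h ℕ.* 2) ≈ - (x ^ suc (h ℕ.* 2))
  -^-odd x zero    = solve 2 (λ x y → :- x :* y := :- (x :* y)) refl x 1#
  -^-odd x (suc h) = begin
    - x * (- x * (- x) ^ suc (h ℕ.* 2))
      ≈⟨ *-congˡ (*-congˡ (-^-odd x h)) ⟩
    - x * (- x * - (x ^ suc (h ℕ.* 2)))
      ≈⟨ solve 2 (λ x y → :- x :* (:- x :* :- y) := :- (x :* (x :* y))) refl x (x ^ suc (h ℕ.* 2)) ⟩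
    - (x * (x * x ^ suc (h ℕ.* 2))) ∎

  -- The zeros of Z² − √R (z − y) Z − R are √R z and − √R y, so the Lucas
  -- sequence in eval-polySum-⊖ splits.
  eval-P : ∀ k R nsq → Odd k → 1 ℕ.≤ k → ∀ {s y z} → s * s ≈ ι R → z * y ≈ 1# →
    eval (P k R nsq) (s * (z - y)) ≈ s * (z ^ k - y ^ k)
  eval-P k R nsq odd 1≤k {s} {y} {z} s²≈R zy≈1 = begin
    eval (P k R nsq) x
      ≈⟨ eval-scale ((ℚ.- 1ℚ) ^ℚ h) S x ⟩
    ι ((ℚ.- 1ℚ) ^ℚ h) * eval S x
      ≈⟨ *-cong (ι-^ (ℚ.- 1ℚ) h) (eval-polySum-⊖ h k (ℚ.- R) -R≢0 h x 1≤k (odd⇒<2*suc-half k odd)) ⟩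
    ι (ℚ.- 1ℚ) ^ h * (r ^ h * V x (ι (ℚ.- R)) k)
      ≈⟨ *-congˡ (*-congˡ (V-closed x (ι (ℚ.- R)) x≈ -R≈ k)) ⟩
    ι (ℚ.- 1ℚ) ^ h * (r ^ h * ((s * z) ^ k + (- (s * y)) ^ k))
      ≈⟨ *-congˡ (*-congˡ (+-cong (^-distrib-* s z k) (trans neg (-‿cong (^-distrib-* s y k))))) ⟩
    ι (ℚ.- 1ℚ) ^ h * (r ^ h * (s ^ k * z ^ k - s ^ k * y ^ k))
      ≈⟨ solve 5 (λ a b s z y → a :* (b :* (s :* z :- s :* y)) := a :* (b :* s) :* (z :- y))
           refl (ι (ℚ.- 1ℚ) ^ h) (r ^ h) (s ^ k) (z ^ k) (y ^ k) ⟩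
    ι (ℚ.- 1ℚ) ^ h * (r ^ h * s ^ k) * (z ^ k - y ^ k)
      ≈⟨ *-congʳ (*-congˡ (*-congˡ sᵏ≈)) ⟩
    ι (ℚ.- 1ℚ) ^ h * (r ^ h * (s * ι R ^ h)) * (z ^ k - y ^ k)
      ≈⟨ *-congʳ (solve 4 (λ a b s c → a :* (b :* (s :* c)) := s :* (a :* c :* b))
           refl (ι (ℚ.- 1ℚ) ^ h) (r ^ h) s (ι R ^ h)) ⟩
    s * (ι (ℚ.- 1ℚ) ^ h * ι R ^ h * r ^ h) * (z ^ k - y ^ k)
      ≈⟨ *-congʳ (*-congˡ unit) ⟩
    s * 1# * (z ^ k - y ^ k)
      ≈⟨ *-congʳ (*-identityʳ s) ⟩
    s * (z ^ k - y ^ k) ∎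
    where
    h = half k
    -R≢0 = nonSquare⇒-≢0 nsq
    r = ι (invℚ (ℚ.- R) -R≢0)
    S = polySum h (λ j → c k j ℚ.* (ℚ.- R) ^ℚ[ -R≢0 ] (j ℤ.⊖ h)) (λ j → k ℕ.∸ 2 ℕ.* j)
    x = s * (z - y)
    x≈ : x ≈ s * z + - (s * y)
    x≈ = solve 3 (λ s z y → s :* (z :- y) := s :* z :+ :- (s :* y)) refl s z y
    -R≈ : ι (ℚ.- R) ≈ s * z * - (s * y)
    -R≈ = begin
      ι (ℚ.- R)             ≈⟨ -‿homo R ⟩
      - ι R                 ≈⟨ -‿cong (trans (*-cong s²≈R zy≈1) (*-identityʳ _)) ⟨
      - (s * s * (z * y))   ≈⟨ solve 3 (λ s z y → :- (s :* s :* (z :* y)) := s :* z :* :- (s :* y))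
           refl s z y ⟩
      s * z * - (s * y)     ∎
    neg : (- (s * y)) ^ k ≈ - ((s * y) ^ k)
    neg = ≡.subst (λ m → (- (s * y)) ^ m ≈ - ((s * y) ^ m)) (≡.sym (odd-half k odd)) (-^-odd (s * y) h)
    sᵏ≈ : s ^ k ≈ s * ι R ^ h
    sᵏ≈ = begin
      s ^ k               ≈⟨ ^-congʳ s (odd-half k odd) ⟩
      s * s ^ (h ℕ.* 2)   ≈⟨ *-congˡ (^-double s h) ⟩
      s * (s ^ h * s ^ h) ≈⟨ *-congˡ (^-distrib-* s s h) ⟨
      s * (s * s) ^ h     ≈⟨ *-congˡ (^-congˡ h s²≈R) ⟩
      s * ι R ^ h         ∎
    -- The sign in `P` turns the R^h left over from s^k into (-R)^h, which cancels the power pulled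
    -- out of the sum.
    unit : ι (ℚ.- 1ℚ) ^ h * ι R ^ h * r ^ h ≈ 1#
    unit = begin
      ι (ℚ.- 1ℚ) ^ h * ι R ^ h * r ^ h ≈⟨ *-congʳ (^-distrib-* (ι (ℚ.- 1ℚ)) (ι R) h) ⟨
      (ι (ℚ.- 1ℚ) * ι R) ^ h * r ^ h   ≈⟨ *-congʳ (^-congˡ h (trans (sym (*-homo (ℚ.- 1ℚ) R)) (⟦⟧-cong (≡.trans (≡.sym (ℚₚ.neg-distribˡ-* 1ℚ R)) (cong ℚ.-_ (ℚₚ.*-identityˡ R)))))) ⟩
      ι (ℚ.- R) ^ h * r ^ h            ≈⟨ ^-inverse h (ι-inverse -R≢0) ⟩
      1#                               ∎

  -- Inverses, quotients and powers of roots of unity.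

  inverse-unique : ∀ {x y z} → x * z ≈ 1# → z * y ≈ 1# → x ≈ y
  inverse-unique {x} {y} {z} xz≈1 zy≈1 = begin
    x           ≈⟨ *-identityʳ x ⟨
    x * 1#      ≈⟨ *-congˡ zy≈1 ⟨
    x * (z * y) ≈⟨ *-assoc x z y ⟨
    x * z * y   ≈⟨ *-congʳ xz≈1 ⟩
    1# * y      ≈⟨ *-identityˡ y ⟩
    y           ∎

  ÷-unique : ∀ {x y t} (y#0 : y # 0#) → x ≈ y * t → x ÷ y [ y#0 ] ≈ t
  ÷-unique {x} {y} {t} y#0 x≈yt = begin
    x * y⁻¹       ≈⟨ *-congʳ x≈yt ⟩
    y * t * y⁻¹   ≈⟨ solve 3 (λ y t y⁻¹ → y :* t :* y⁻¹ := y⁻¹ :* y :* t) refl y t y⁻¹ ⟩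
    y⁻¹ * y * t   ≈⟨ *-congʳ (inv-inverseˡ y y#0) ⟩
    1# * t        ≈⟨ *-identityˡ t ⟩
    t             ∎
    where y⁻¹ = inv y y#0

  ^[]-neg : ∀ x (x#0 : x # 0#) k → x ^[ x#0 ] (ℤ.- + k) ≈ inv x x#0 ^ k
  ^[]-neg x x#0 zero    = refl
  ^[]-neg x x#0 (suc k) = refl

  -- Both sides are inverse to x^k.
  ^n≈1⇒^[n∸k]≈^k : ∀ {x y} n k → k ≤ n → x * y ≈ 1# → x ^ n ≈ 1# → x ^ (n ∸ k) ≈ y ^ k
  ^n≈1⇒^[n∸k]≈^k {x} {y} n k k≤n xy≈1 xⁿ≈1 = inverse-unique
    (trans (sym (^-homo-* x (n ∸ k) k)) (trans (^-congʳ x (ℕₚ.m∸n+n≡m k≤n)) xⁿ≈1))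
    (^-inverse k xy≈1)

  -- Relations at a zero `u` of `f`.

  module RootsProperties
    (n : ℕ) (3≤n : 3 ≤ n) (n-odd : Odd n)
    (d R : ℚ) (d≢0 : d ≢ 0ℚ) (nsq : ¬ IsSquare R)
    (s : Carrier) (s²≈R : s * s ≈ ι R)
    (u : Carrier) (fu≈0 : eval (f n d R) u ≈ 0#)
    (ζ : Carrier) (ζ-prim : IsPrimitiveRoot n ζ)
    where

    open Roots E n d R nsq s u ζ ζ-prim

    1≤n : 1 ≤ n
    1≤n = ℕₚ.≤-trans (s≤s z≤n) 3≤n

    D≢0 = nonSquare⇒D≢0 d nsq
    2R≢0 = nonSquare⇒2R≢0 nsq

    h = half n
    2ᴷ = ι 2ℚ
    4ᴷ = ι 4ℚ
    δ = ι d
    r = ι R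
    Q = ι (D d R)
    e = ι (invℚ (D d R) D≢0)
    i = ι (invℚ (2ℚ ℚ.* R) 2R≢0)
    -- The value of F_(n-1)(Z/√D) at `u`, so that A(u) = (B - du/D)/(2R).
    B = e ^ h * V u Q (h ℕ.* 2)
    z = inv ζ (primitive⇒#0 ζ-prim)
    v = 2ᴷ * (Q * A[u]) * s
    α = ι ℚ.½ * (u + v)
    β = ι ℚ.½ * (u - v)

    Q≈ : Q ≈ δ * δ - r
    Q≈ = trans (ι-minus (d ℚ.* d) R) (+-congʳ (*-homo d d))

    2ri≈1 : 2ᴷ * r * i ≈ 1#
    2ri≈1 = trans (*-congʳ (sym (*-homo 2ℚ R))) (ι-inverse 2R≢0)

    Qe≈1 : Q * e ≈ 1#
    Qe≈1 = ι-inverse D≢0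

    Vₙ≈ : V u Q n ≈ 2ᴷ * δ * Q ^ h
    Vₙ≈ = x-y≈0⇒x≈y _ _ (trans (sym (eval-f n d R u n-odd 1≤n)) fu≈0)

    -- Clears both denominators of A(u). Since s² = R, the left side is also `s * v`.
    2rQA≈ : 2ᴷ * r * (Q * A[u]) ≈ Q * B - u * δ
    2rQA≈ = begin
      2ᴷ * r * (Q * A[u])
        ≈⟨ *-congˡ (*-congˡ (eval-A n d R nsq u n-odd (ℕₚ.≤-trans (s≤s (s≤s z≤n)) 3≤n))) ⟩
      2ᴷ * r * (Q * (i * (B - δ * e * u)))
        ≈⟨ solve 8 (λ t r q i b δ e u → t :* r :* (q :* (i :* (b :- δ :* e :* u)))
             := t :* r :* i :* (q :* b :- q :* e :* (u :* δ))) refl 2ᴷ r Q i B δ e u ⟩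
      2ᴷ * r * i * (Q * B - Q * e * (u * δ))
        ≈⟨ *-cong 2ri≈1 (+-congˡ (-‿cong (trans (*-congʳ Qe≈1) (*-identityˡ _)))) ⟩
      1# * (Q * B - u * δ)
        ≈⟨ *-identityˡ _ ⟩
      Q * B - u * δ ∎

    eʰVₙ≈2δ : e ^ h * V u Q n ≈ 2ᴷ * δ
    eʰVₙ≈2δ = begin
      e ^ h * V u Q n              ≈⟨ *-congˡ Vₙ≈ ⟩
      e ^ h * (2ᴷ * δ * Q ^ h)     ≈⟨ solve 3 (λ a b c → a :* (b :* c) := b :* (c :* a))
           refl (e ^ h) (2ᴷ * δ) (Q ^ h) ⟩
      2ᴷ * δ * (Q ^ h * e ^ h)     ≈⟨ *-congˡ (^-inverse h Qe≈1) ⟩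
      2ᴷ * δ * 1#                  ≈⟨ *-identityʳ _ ⟩
      2ᴷ * δ                       ∎

    -- `V-norm` between the indices n - 1 and n, divided by D^(n-1). The value 2d of D^(-h) V_n
    -- expresses that `u` is a zero of `f`.
    norm : 2ᴷ * δ * (2ᴷ * δ) - u * (2ᴷ * δ) * B + Q * (B * B) ≈ 4ᴷ * Q - u * u
    norm = begin
      2ᴷ * δ * (2ᴷ * δ) - u * (2ᴷ * δ) * B + Q * (B * B)
        ≈⟨ +-congʳ (+-cong (*-cong eq eq) (-‿cong (*-congʳ (*-congˡ eq)))) ⟩
      g * g - u * g * B + Q * (B * B)
        ≈⟨ solve 5 (λ k x y u q → k :* x :* (k :* x) :- u :* (k :* x) :* (k :* y) :+ q :* (k :* y :* (k :* y))
             := k :* k :* (x :* x :- u :* x :* y :+ q :* (y :* y))) refl (e ^ h) x y u Q ⟩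
      e ^ h * e ^ h * (x * x - u * x * y + Q * (y * y))
        ≈⟨ *-congˡ (trans (V-norm u Q (h ℕ.* 2)) (*-congˡ (^-double Q h))) ⟩
      e ^ h * e ^ h * ((4ᴷ * Q - u * u) * (Q ^ h * Q ^ h))
        ≈⟨ solve 3 (λ k w p → k :* k :* (w :* (p :* p)) := w :* (p :* k) :* (p :* k))
             refl (e ^ h) (4ᴷ * Q - u * u) (Q ^ h) ⟩
      (4ᴷ * Q - u * u) * (Q ^ h * e ^ h) * (Q ^ h * e ^ h)
        ≈⟨ *-cong (*-congˡ (^-inverse h Qe≈1)) (^-inverse h Qe≈1) ⟩
      (4ᴷ * Q - u * u) * 1# * 1#
        ≈⟨ trans (*-identityʳ _) (*-identityʳ _) ⟩
      4ᴷ * Q - u * u ∎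
      where
      x = V u Q (suc (h ℕ.* 2))
      y = V u Q (h ℕ.* 2)
      g = e ^ h * x
      eq : 2ᴷ * δ ≈ g
      eq = trans (sym eʰVₙ≈2δ) (*-congˡ (reflexive (cong (V u Q) (odd-half n n-odd))))

    -- Multiplied by R = s², the claim concerns only `u`, `B`, d and D, where `norm` applies.
    -- Afterwards R is cancelled by means of 1/(2R).
    v²≈ : v * v ≈ u * u - 4ᴷ * Q
    v²≈ = begin
      v * v                                   ≈⟨ *-identityˡ _ ⟨
      1# * (v * v)                            ≈⟨ *-congʳ 2ri≈1 ⟨
      2ᴷ * r * i * (v * v)                    ≈⟨ solve 4 (λ t r i w → t :* r :* i :* w
           := t :* i :* (r :* w))
           refl 2ᴷ r i (v * v) ⟩
      2ᴷ * i * (r * (v * v))                  ≈⟨ *-congˡ rv² ⟩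
      2ᴷ * i * (r * (u * u - 4ᴷ * Q))         ≈⟨ solve 4 (λ t r i w → t :* r :* i :* w
           := t :* i :* (r :* w))
           refl 2ᴷ r i (u * u - 4ᴷ * Q) ⟨
      2ᴷ * r * i * (u * u - 4ᴷ * Q)           ≈⟨ *-congʳ 2ri≈1 ⟩
      1# * (u * u - 4ᴷ * Q)                   ≈⟨ *-identityˡ _ ⟩
      u * u - 4ᴷ * Q                          ∎
      where
      sv≈ : s * v ≈ Q * B - u * δ
      sv≈ = begin
        s * (2ᴷ * (Q * A[u]) * s)  ≈⟨ solve 3 (λ s t w → s :* (t :* w :* s) := t :* (s :* s) :* w)
             refl s 2ᴷ (Q * A[u]) ⟩
        2ᴷ * (s * s) * (Q * A[u])  ≈⟨ *-congʳ (*-congˡ s²≈R) ⟩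
        2ᴷ * r * (Q * A[u])        ≈⟨ 2rQA≈ ⟩
        Q * B - u * δ              ∎
      r≈ : r ≈ δ * δ - Q
      r≈ = begin
        r                       ≈⟨ solve 2 (λ r x → r := x :- (x :- r)) refl r (δ * δ) ⟩
        δ * δ - (δ * δ - r)     ≈⟨ +-congˡ (-‿cong Q≈) ⟨
        δ * δ - Q               ∎
      rv² : r * (v * v) ≈ r * (u * u - 4ᴷ * Q)
      rv² = begin
        r * (v * v)
          ≈⟨ *-congʳ s²≈R ⟨
        s * s * (v * v)
          ≈⟨ solve 2 (λ s v → s :* s :* (v :* v) := s :* v :* (s :* v)) refl s v ⟩
        s * v * (s * v)
          ≈⟨ *-cong sv≈ sv≈ ⟩
        (Q * B - u * δ) * (Q * B - u * δ)
          -- Completing the square backwards: D times the left side of `norm` has the same terms in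
          -- `B`, so `norm` eliminates `B`. What remains factors through d² - D = R.
          ≈⟨ solve 4 (λ q b u d → (q :* b :- u :* d) :* (q :* b :- u :* d)
               := q :* (con 2ℚ :* d :* (con 2ℚ :* d) :- u :* (con 2ℚ :* d) :* b :+ q :* (b :* b))
                  :- con 4ℚ :* q :* (d :* d) :+ u :* u :* (d :* d)) refl Q B u δ ⟩
        Q * (2ᴷ * δ * (2ᴷ * δ) - u * (2ᴷ * δ) * B + Q * (B * B)) - 4ᴷ * Q * (δ * δ) + u * u * (δ * δ)
          ≈⟨ +-congʳ (+-congʳ (*-congˡ norm)) ⟩
        Q * (4ᴷ * Q - u * u) - 4ᴷ * Q * (δ * δ) + u * u * (δ * δ)
          ≈⟨ solve 3 (λ q u d → q :* (con 4ℚ :* q :- u :* u) :- con 4ℚ :* q :* (d :* d) :+ u :* u :* (d :* d)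
               := (d :* d :- q) :* (u :* u :- con 4ℚ :* q)) refl Q u δ ⟩
        (δ * δ - Q) * (u * u - 4ᴷ * Q)
          ≈⟨ *-congʳ r≈ ⟨
        r * (u * u - 4ᴷ * Q) ∎

    α+β≈u : u ≈ α + β
    α+β≈u = solve 2 (λ u v → u := con ℚ.½ :* (u :+ v) :+ con ℚ.½ :* (u :- v)) refl u v

    αβ≈Q : Q ≈ α * β
    αβ≈Q = begin
      Q
        ≈⟨ solve 2 (λ q u → q := con ℚ.½ :* con ℚ.½ :* (u :* u :- (u :* u :- con 4ℚ :* q)))
             refl Q u ⟩
      ι ℚ.½ * ι ℚ.½ * (u * u - (u * u - 4ᴷ * Q))
        ≈⟨ *-congˡ (+-congˡ (-‿cong v²≈)) ⟨
      ι ℚ.½ * ι ℚ.½ * (u * u - v * v)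
        ≈⟨ solve 2 (λ u v → con ℚ.½ :* con ℚ.½ :* (u :* u :- v :* v)
             := con ℚ.½ :* (u :+ v) :* (con ℚ.½ :* (u :- v)))
             refl u v ⟩
      α * β ∎

    αⁿ+βⁿ≈ : α ^ n + β ^ n ≈ 2ᴷ * δ * Q ^ h
    αⁿ+βⁿ≈ = trans (sym (V-closed u Q α+β≈u αβ≈Q n)) Vₙ≈

    -- Invertibility of `u` and A(u).

    u#0 : u # 0#
    u#0 = let w , V≈wu = V-odd u Q h in unit⇒#0 (begin
      -- Apartness from 0 is shown by an explicit inverse: w u = V_n(u) = 2d D^h, so w/(2d D^h)
      -- serves, and d ≠ 0 enters here.
      ι ℚ.½ * d⁻¹ * e ^ h * w * u
        ≈⟨ *-assoc _ w u ⟩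
      ι ℚ.½ * d⁻¹ * e ^ h * (w * u)
        ≈⟨ *-congˡ (trans (reflexive (cong (V u Q) (odd-half n n-odd))) V≈wu) ⟨
      ι ℚ.½ * d⁻¹ * e ^ h * V u Q n
        ≈⟨ *-assoc _ _ _ ⟩
      ι ℚ.½ * d⁻¹ * (e ^ h * V u Q n)
        ≈⟨ *-congˡ eʰVₙ≈2δ ⟩
      ι ℚ.½ * d⁻¹ * (2ᴷ * δ)
        ≈⟨ solve 2 (λ x y → con ℚ.½ :* x :* (con 2ℚ :* y) := y :* x) refl d⁻¹ δ ⟩
      δ * d⁻¹
        ≈⟨ ι-inverse d≢0 ⟩
      1# ∎)
      where d⁻¹ = ι (invℚ d d≢0)

    A#0 : A[u] # 0#
    A#0 = let t , W≈ = ^-diff-factor α β n in unit⇒#0 (begin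
      -- The inverse of A(u) is read off from W² = W t (α - β) = W t · 2 D A(u) √R and W² = 4R
      -- D^(2h). The constant ½ `i` `e`^(2h) is 1/(4R D^(2h)).
      ι ℚ.½ * i * (e ^ h * e ^ h) * W * (t * (2ᴷ * Q * s)) * A[u]
        -- `α - β` is written out down to `A[u]`, so that the solver sees A(u) as a factor and
        -- cancels `u`.
        ≈⟨ solve 7 (λ k w t q a s y → k :* w :* (t :* (con 2ℚ :* q :* s)) :* a
             := k :* (w :* (t :* (con ℚ.½ :* (y :+ con 2ℚ :* (q :* a) :* s) :- con ℚ.½ :* (y :- con 2ℚ :* (q :* a) :* s)))))
             refl (ι ℚ.½ * i * (e ^ h * e ^ h)) W t Q A[u] s u ⟩
      ι ℚ.½ * i * (e ^ h * e ^ h) * (W * (t * (α - β)))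
        ≈⟨ *-congˡ (*-congˡ W≈) ⟨
      ι ℚ.½ * i * (e ^ h * e ^ h) * (W * W)
        ≈⟨ *-congˡ W²≈ ⟩
      ι ℚ.½ * i * (e ^ h * e ^ h) * (4ᴷ * r * (Q ^ h * Q ^ h))
        ≈⟨ solve 4 (λ i e r q → con ℚ.½ :* i :* (e :* e) :* (con 4ℚ :* r :* (q :* q))
             := con 2ℚ :* r :* i :* (q :* e) :* (q :* e)) refl i (e ^ h) r (Q ^ h) ⟩
      2ᴷ * r * i * (Q ^ h * e ^ h) * (Q ^ h * e ^ h)
        ≈⟨ *-cong (*-cong 2ri≈1 (^-inverse h Qe≈1)) (^-inverse h Qe≈1) ⟩
      1# * 1# * 1#
        ≈⟨ trans (*-identityʳ _) (*-identityʳ _) ⟩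
      1# ∎)
      where
      W = α ^ n - β ^ n
      αⁿβⁿ≈ : α ^ n * β ^ n ≈ Q * (Q ^ h * Q ^ h)
      αⁿβⁿ≈ = begin
        α ^ n * β ^ n         ≈⟨ ^-distrib-* α β n ⟨
        (α * β) ^ n           ≈⟨ ^-congˡ n αβ≈Q ⟨
        Q ^ n                 ≈⟨ ^-congʳ Q (odd-half n n-odd) ⟩
        Q * Q ^ (h ℕ.* 2)     ≈⟨ *-congˡ (^-double Q h) ⟩
        Q * (Q ^ h * Q ^ h)   ∎
      -- (x - y)² = (x + y)² - 4xy gives 4d² D^(2h) - 4 D^n, and d² - D = R.
      W²≈ : W * W ≈ 4ᴷ * r * (Q ^ h * Q ^ h)
      W²≈ = begin
        W * W
          ≈⟨ solve 2 (λ x y → (x :- y) :* (x :- y) := (x :+ y) :* (x :+ y) :- con 4ℚ :* (x :* y))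
               refl (α ^ n) (β ^ n) ⟩
        (α ^ n + β ^ n) * (α ^ n + β ^ n) - 4ᴷ * (α ^ n * β ^ n)
          ≈⟨ +-cong (*-cong αⁿ+βⁿ≈ αⁿ+βⁿ≈) (-‿cong (*-congˡ (trans αⁿβⁿ≈ (*-congʳ Q≈)))) ⟩
        2ᴷ * δ * Q ^ h * (2ᴷ * δ * Q ^ h) - 4ᴷ * ((δ * δ - r) * (Q ^ h * Q ^ h))
          ≈⟨ solve 3 (λ d q r → con 2ℚ :* d :* q :* (con 2ℚ :* d :* q) :- con 4ℚ :* ((d :* d :- r) :* (q :* q))
               := con 4ℚ :* r :* (q :* q)) refl δ (Q ^ h) r ⟩
        4ᴷ * r * (Q ^ h * Q ^ h) ∎

    -- The elements u_k and their conjugates.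

    ζz≈1 : ζ * z ≈ 1#
    ζz≈1 = trans (*-comm ζ z) (inv-inverseˡ ζ _)

    zζ≈1 : z * ζ ≈ 1#
    zζ≈1 = inv-inverseˡ ζ _

    ζⁿ≈1 : ζ ^ n ≈ 1#
    ζⁿ≈1 = IsPrimitiveRoot.ζⁿ≈1 ζ-prim

    zⁿ≈1 : z ^ n ≈ 1#
    zⁿ≈1 = trans (sym (*-identityˡ _)) (trans (*-congʳ (sym ζⁿ≈1)) (^-inverse n ζz≈1))

    -- With x = ζ^k and y = ζ^(-k) this is u_k. Exchanging the arguments replaces k by n - k and
    -- flips the sign of the second summand only.
    conj : Carrier → Carrier → Carrier
    conj x y = ι ℚ.½ * u * (x + y) + Q * A[u] * s * (x - y)

    uₖ≈ : ∀ k {x y} → ζ ^ k ≈ x → z ^ k ≈ y → uₖ k ≈ conj x y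
    uₖ≈ k ζᵏ≈x zᵏ≈y =
      let ζ⁻ᵏ≈y = trans (^[]-neg ζ _ k) zᵏ≈y in
      +-cong (*-congˡ (+-cong ζᵏ≈x ζ⁻ᵏ≈y)) (*-congˡ (+-cong ζᵏ≈x (-‿cong ζ⁻ᵏ≈y)))

    u₋ₖ≈ : ∀ k → k ≤ n → uₖ (n ∸ k) ≈ conj (z ^ k) (ζ ^ k)
    u₋ₖ≈ k k≤n = uₖ≈ (n ∸ k) (^n≈1⇒^[n∸k]≈^k n k k≤n ζz≈1 ζⁿ≈1) (^n≈1⇒^[n∸k]≈^k n k k≤n zζ≈1 zⁿ≈1)

    root-pow : ∀ {x} → x ^ n ≈ 1# → ∀ y k → (y * x ^ k) ^ n ≈ y ^ n
    root-pow {x} xⁿ≈1 y k = begin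
      (y * x ^ k) ^ n        ≈⟨ ^-distrib-* y (x ^ k) n ⟩
      y ^ n * (x ^ k) ^ n    ≈⟨ *-congˡ (^-assocʳ x k n) ⟩
      y ^ n * x ^ (k ℕ.* n)  ≈⟨ *-congˡ (^-congʳ x (ℕₚ.*-comm k n)) ⟩
      y ^ n * x ^ (n ℕ.* k)  ≈⟨ *-congˡ (^-assocʳ x n k) ⟨
      y ^ n * (x ^ n) ^ k    ≈⟨ *-congˡ (trans (^-congˡ k xⁿ≈1) (1^n≈1 k)) ⟩
      y ^ n * 1#             ≈⟨ *-identityʳ _ ⟩
      y ^ n                  ∎

    -- Twisting `α` by ζ^k and `β` by ζ^(-k) changes neither the product D nor the sum of the n-th
    -- powers, hence not the value of V_n.
    uₖ-root : ∀ k → eval (f n d R) (uₖ k) ≈ 0#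
    uₖ-root k = begin
      eval (f n d R) (uₖ k)
        ≈⟨ eval-f n d R (uₖ k) n-odd 1≤n ⟩
      V (uₖ k) Q n - 2ᴷ * δ * Q ^ h
        ≈⟨ +-congʳ (V-closed (uₖ k) Q sum≈ prod≈ n) ⟩
      ((α * ζ ^ k) ^ n + (β * z ^ k) ^ n) - 2ᴷ * δ * Q ^ h
        ≈⟨ +-congʳ (trans (+-cong (root-pow ζⁿ≈1 α k) (root-pow zⁿ≈1 β k)) αⁿ+βⁿ≈) ⟩
      2ᴷ * δ * Q ^ h - 2ᴷ * δ * Q ^ h
        ≈⟨ -‿inverseʳ _ ⟩
      0# ∎
      where
      sum≈ : uₖ k ≈ α * ζ ^ k + β * z ^ k
      sum≈ = trans (uₖ≈ k refl refl)
        (solve 5 (λ u w s x y → con ℚ.½ :* u :* (x :+ y) :+ w :* s :* (x :- y)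
          := con ℚ.½ :* (u :+ con 2ℚ :* w :* s) :* x :+ con ℚ.½ :* (u :- con 2ℚ :* w :* s) :* y)
          refl u (Q * A[u]) s (ζ ^ k) (z ^ k))
      prod≈ : Q ≈ α * ζ ^ k * (β * z ^ k)
      prod≈ = begin
        Q                             ≈⟨ αβ≈Q ⟩
        α * β                         ≈⟨ *-identityʳ _ ⟨
        α * β * 1#                    ≈⟨ *-congˡ (^-inverse k ζz≈1) ⟨
        α * β * (ζ ^ k * z ^ k)       ≈⟨ solve 4 (λ a b x y → a :* b :* (x :* y)
             := a :* x :* (b :* y))
             refl α β (ζ ^ k) (z ^ k) ⟩
        α * ζ ^ k * (β * z ^ k)       ∎

    -- The two summands of the formula.

    u₁≈ : uₖ 1 ≈ conj ζ z
    u₁≈ = uₖ≈ 1 (*-identityʳ ζ) (*-identityʳ z)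

    u₋₁≈ : uₖ (n ∸ 1) ≈ conj z ζ
    u₋₁≈ = trans (u₋ₖ≈ 1 1≤n) (+-cong (*-congˡ (+-cong z1 ζ1)) (*-congˡ (+-cong z1 (-‿cong ζ1))))
      where
      z1 = *-identityʳ z
      ζ1 = *-identityʳ ζ

    -- The √R terms cancel in u_1 + u_(n-1), so the argument of `F k` is ζ + ζ⁻¹. The sequence with
    -- q = 1 = ζ ζ⁻¹ then splits into powers of ζ and ζ⁻¹.
    F-part≈ : ∀ k → 1 ≤ k → F-part u#0 k ≈ ι ℚ.½ * u * (ζ ^ k + z ^ k)
    F-part≈ k 1≤k = *-congˡ (begin
      eval (F k) ((uₖ 1 + uₖ (n ∸ 1)) ÷ u [ u#0 ])
        ≈⟨ eval-cong (F k) (÷-unique u#0 (begin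
            uₖ 1 + uₖ (n ∸ 1)
              ≈⟨ +-cong u₁≈ u₋₁≈ ⟩
            conj ζ z + conj z ζ
              ≈⟨ solve 4 (λ u w x y → con ℚ.½ :* u :* (x :+ y) :+ w :* (x :- y) :+ (con ℚ.½ :* u :* (y :+ x) :+ w :* (y :- x))
                   := u :* (x :+ y)) refl u (Q * A[u] * s) ζ z ⟩
            u * (ζ + z) ∎)) ⟩
      eval (F k) (ζ + z)
        ≈⟨ eval-F k (ζ + z) 1≤k ⟩
      V (ζ + z) 1# k
        ≈⟨ V-closed (ζ + z) 1# refl (sym ζz≈1) k ⟩
      ζ ^ k + z ^ k ∎)

    -- In u_1 - u_(n-1) the terms with u/2 cancel instead, which leaves √R (ζ - ζ⁻¹) as the
    -- argument, the shape treated by `eval-P`.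
    P-part≈ : ∀ k → Odd k → 1 ≤ k → P-part A#0 k ≈ Q * A[u] * s * (ζ ^ k - z ^ k)
    P-part≈ k k-odd 1≤k = trans (*-congˡ (begin
      eval (P k R nsq) ((uₖ 1 - uₖ (n ∸ 1)) ÷ 2DA[u] [ 2DA[u]#0 A#0 ])
        ≈⟨ eval-cong (P k R nsq) (÷-unique (2DA[u]#0 A#0) (begin
            uₖ 1 - uₖ (n ∸ 1)
              ≈⟨ +-cong u₁≈ (-‿cong u₋₁≈) ⟩
            conj ζ z - conj z ζ
              ≈⟨ solve 6 (λ u q a s x y → con ℚ.½ :* u :* (x :+ y) :+ q :* a :* s :* (x :- y) :- (con ℚ.½ :* u :* (y :+ x) :+ q :* a :* s :* (y :- x))
                   := con 2ℚ :* q :* a :* (s :* (x :- y))) refl u Q A[u] s ζ z ⟩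
            2ᴷ * Q * A[u] * (s * (ζ - z))
              ≈⟨ *-congʳ (*-congʳ (*-homo 2ℚ (D d R))) ⟨
            2DA[u] * (s * (ζ - z)) ∎)) ⟩
      eval (P k R nsq) (s * (ζ - z))
        ≈⟨ eval-P k R nsq k-odd 1≤k s²≈R ζz≈1 ⟩
      s * (ζ ^ k - z ^ k) ∎)) (sym (*-assoc _ s _))

    uₖ≈F+P : ∀ k → Odd k → 1 ≤ k → uₖ k ≈ F-part u#0 k + P-part A#0 k
    uₖ≈F+P k k-odd 1≤k = trans (uₖ≈ k refl refl) (sym (+-cong (F-part≈ k 1≤k) (P-part≈ k k-odd 1≤k)))

    u₋ₖ≈F-P : ∀ k → Odd k → 1 ≤ k → k ≤ n → uₖ (n ∸ k) ≈ F-part u#0 k - P-part A#0 k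
    u₋ₖ≈F-P k k-odd 1≤k k≤n = begin
      uₖ (n ∸ k)
        ≈⟨ u₋ₖ≈ k k≤n ⟩
      conj (z ^ k) (ζ ^ k)
        ≈⟨ solve 4 (λ a w x y → a :* (y :+ x) :+ w :* (y :- x) := a :* (x :+ y) :- w :* (x :- y))
             refl (ι ℚ.½ * u) (Q * A[u] * s) (ζ ^ k) (z ^ k) ⟩
      ι ℚ.½ * u * (ζ ^ k + z ^ k) - Q * A[u] * s * (ζ ^ k - z ^ k)
        ≈⟨ +-cong (F-part≈ k 1≤k) (-‿cong (P-part≈ k k-odd 1≤k)) ⟨
      F-part u#0 k - P-part A#0 k ∎

theorem3 : ∀ {a ℓ₁ ℓ₂} (E : Extension a ℓ₁ ℓ₂) → let open Extension E in
    (n : ℕ) → 3 ≤ n → Odd n →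
    (d R : ℚ) → d ≢ 0ℚ → (nsq : ¬ IsSquare R) →
    (√R : Carrier) → √R * √R ≈ ι R →
    (u : Carrier) → eval (f n d R) u ≈ 0# →
    (ζ : Carrier) (ζ-prim : IsPrimitiveRoot n ζ) →
    let open Roots E n d R nsq √R u ζ ζ-prim in
    (∀ k → k < n → eval (f n d R) (uₖ k) ≈ 0#) ×
    Σ (u # 0#) λ u#0 →
    Σ (A[u] # 0#) λ A#0 →
    ∀ k → Odd k → 1 ≤ k → k ≤ n ∸ 1 →
    (uₖ k ≈ F-part u#0 k + P-part A#0 k) ×
    (uₖ (n ∸ k) ≈ F-part u#0 k - P-part A#0 k)
theorem3 E n 3≤n n-odd d R d≢0 nsq √R √R²≈R u fu≈0 ζ ζ-prim =
  (λ k _ → uₖ-root k) , u#0 , A#0 , λ k k-odd 1≤k k≤n-1 →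
    uₖ≈F+P k k-odd 1≤k , u₋ₖ≈F-P k k-odd 1≤k (ℕₚ.≤-trans k≤n-1 (ℕₚ.m∸n≤m n 1))
  where open ExtensionProperties.RootsProperties E n 3≤n n-odd d R d≢0 nsq √R √R²≈R u fu≈0 ζ ζ-prim
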